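{- Let $k\ge 2$ and $n\ge 1$ be integers, and let $\gamma^{(1)},\delta^{(1)},\ldots,\gamma^{(k)},\delta^{(k)}$ be compositions of $n$. If for every $t\in[k]$ the compositions $\gamma^{(t)}$ and $\delta^{(t)}$ have the same length, then $c(\gamma^{(1)},\ldots,\gamma^{(k)})=c(\delta^{(1)},\ldots,\delta^{(k)})$, where $c(\gamma^{(1)},\ldots,\gamma^{(k)})$ denotes the number of colored factorizations of the permutation $(1,2,\ldots,n)$ having color-compositions $(\gamma^{(1)},\ldots,\gamma^{(k)})$.
   Context: For a positive integer $m$, $[m]=\{1,\ldots,m\}$. A composition of $n$ is a finite sequence of positive integers (its parts) with sum $n$; its length is the number of parts. Given positive integers $p_1,\ldots,p_k$, a $(p_1,\ldots,p_k)$-colored factorization of the long cycle $(1,2,\ldots,n)$ is a tuple $(\pi_1,\ldots,\pi_k,\phi_1,\ldots,\phi_k)$ where $\pi_1,\ldots,\pi_k$ are permutations of $[n]$ with $\pi_1\circ\cdots\circ\pi_k=(1,2,\ldots,n)$ and, for all $t\in[k]$, $\phi_t:[n]\to[p_t]$ is a surjective map such that $\phi_t(a)=\phi_t(b)$ whenever $a,b$ are in the same cycle of $\pi_t$. If $\gamma^{(t)}=(\gamma^{(t)}_1,\ldots,\gamma^{(t)}_{p_t})$ is a composition of $n$ of length $p_t$ for each $t\in[k]$, the colored factorization has color-compositions $(\gamma^{(1)},\ldots,\gamma^{(k)})$ if $|\phi_t^{ -1}(i)|=\gamma^{(t)}_i$ for all $t\in[k]$ and $i\in[p_t]$. -}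

module Defs where

open import Data.Fin using (Fin; zero; suc; toℕ; _≟_)
open import Data.Fin.Permutation using (Permutation′; _⟨$⟩ʳ_; _⟨$⟩ˡ_; _≈_; _∘ₚ_; id; permutation; inverseˡ; inverseʳ)
open import Data.Fin.Properties using (all?; any?)
open import Data.Fin.Subset using (Subset; ∣_∣)
open import Data.List as List using (List; []; _∷_; cartesianProductWith; cartesianProduct; mapMaybe; deduplicate)
open import Data.List.Membership.Propositional.Properties using (∈-allFin; ∈-lookup)
open import Data.List.Relation.Unary.All as All using (All)
open import Data.List.Relation.Unary.AllPairs using (AllPairs; []; _∷_)
open import Data.List.Relation.Unary.Any as Any using (Any; here; there)
open import Data.List.Relation.Unary.Any.Properties using (cartesianProductWith⁺; cartesianProduct⁺; mapMaybe⁺; lookup-index; map⁺)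
open import Data.List.Relation.Unary.Enumerates.Setoid using (IsEnumeration)
import Data.List.Relation.Unary.Enumerates.Setoid.Properties as Enumerates
open import Data.List.Relation.Unary.Unique.DecSetoid.Properties using (deduplicate-!)
open import Data.Maybe using (Maybe; just; nothing)
import Data.Maybe.Relation.Unary.Any as Maybe
open import Data.Nat as ℕ using (ℕ; zero; suc; _>_; NonZero)
open import Data.Nat.DivMod using (_mod_)
open import Data.Nat.GeneralisedArithmetic using (iterate)
open import Data.Nat.ListAction using (sum)
open import Data.Product using (Σ; ∃; _×_; _,_; proj₁; proj₂)
open import Data.Vec using (tabulate)
open import Data.Vec.Properties using (tabulate-cong)
open import Data.Vec.Functional using (foldr)
open import Function using (_∘_; Inverse; Surjective; StrictlySurjective)
open import Function.Consequences.Propositional using (strictlySurjective⇒surjective; surjective⇒strictlySurjective)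
open import Level using (Level; 0ℓ; _⊔_)
open import Relation.Binary using (Setoid; DecSetoid)
import Relation.Binary.Construct.On as On
open import Relation.Binary.PropositionalEquality as ≡ using (_≡_; refl; sym; trans; cong; _≗_)
open import Relation.Nullary using (¬_; Dec; yes; no; does; contradiction)
open import Relation.Nullary.Decidable using (_×-dec_)

record Composition (n : ℕ) : Set where
  field
    parts     : List ℕ
    positive  : All (_> 0) parts
    sum-parts : sum parts ≡ n

  length : ℕ
  length = List.length parts

  part : Fin length → ℕ
  part = List.lookup parts

open Composition public using (length; part)

-- The set [n] is represented by Fin n, the element j of [n] being the
-- element of Fin n with toℕ equal to j - 1.

-- (1,2,…,n)
longCycle : ∀ n .{{_ : NonZero n}} → Fin n → Fin n
longCycle n i = suc (toℕ i) mod n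

-- π₁ ∘ ⋯ ∘ πₖ, the rightmost factor acting first; the library's _∘ₚ_
-- is diagrammatic (its left argument acts first).
composite : ∀ {n k} → (Fin k → Permutation′ n) → Permutation′ n
composite = foldr (λ π ρ → ρ ∘ₚ π) id

SameCycle : ∀ {n} → Permutation′ n → Fin n → Fin n → Set
SameCycle π a b = ∃ λ m → iterate (π ⟨$⟩ʳ_) a m ≡ b

record ColoredFactorization (n : ℕ) .{{_ : NonZero n}} {k : ℕ} (p : Fin k → ℕ) : Set where
  field
    π               : Fin k → Permutation′ n
    φ               : ∀ t → Fin n → Fin (p t)
    factorizes      : ∀ i → composite π ⟨$⟩ʳ i ≡ longCycle n i
    surjective      : ∀ t → Surjective _≡_ _≡_ (φ t)
    cycle-invariant : ∀ t a b → SameCycle (π t) a b → φ t a ≡ φ t b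

preimage : ∀ {n p} → (Fin n → Fin p) → Fin p → Subset n
preimage φ i = tabulate (λ a → does (φ a ≟ i))

module _ {n : ℕ} .{{_ : NonZero n}} {k : ℕ} where

  HasColorCompositions : (γ : Fin k → Composition n) →
                         ColoredFactorization n (length ∘ γ) → Set
  HasColorCompositions γ F = ∀ t i → ∣ preimage (φ t) i ∣ ≡ part (γ t) i
    where open ColoredFactorization F

  -- Two colored factorizations are the same when their permutations and
  -- colorings agree as maps, whatever the proof components are.
  infix 4 _≋_
  _≋_ : ∀ {p : Fin k → ℕ} → ColoredFactorization n p → ColoredFactorization n p → Set
  F ≋ G = (∀ t → F.π t ≈ G.π t) × (∀ t → F.φ t ≗ G.φ t)
    where
    module F = ColoredFactorization F
    module G = ColoredFactorization G

  coloredFactorizations : (Fin k → ℕ) → DecSetoid 0ℓ 0ℓ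
  coloredFactorizations p = record
    { Carrier = ColoredFactorization n p
    ; _≈_ = _≋_
    ; isDecEquivalence = record
      { isEquivalence = record
        { refl  = (λ _ _ → refl) , (λ _ _ → refl)
        ; sym   = λ (e , f) → (λ t i → sym (e t i)) , (λ t i → sym (f t i))
        ; trans = λ (e , f) (e′ , f′) → (λ t i → trans (e t i) (e′ t i)) , (λ t i → trans (f t i) (f′ t i))
        }
      ; _≟_ = λ F G →
          all? (λ t → all? λ i → _ ≟ _) ×-dec all? (λ t → all? λ i → _ ≟ _)
      }
    }

  coloredFactorizationsOf : (Fin k → Composition n) → DecSetoid 0ℓ 0ℓ
  coloredFactorizationsOf γ =
    On.decSetoid {B = Σ _ (HasColorCompositions γ)} (coloredFactorizations (length ∘ γ)) proj₁

Finite : ∀ {a ℓ} → Setoid a ℓ → Set (a ⊔ ℓ)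
Finite S = ∃ λ m → Inverse S (≡.setoid (Fin m))

module _ {a ℓ} (D : DecSetoid a ℓ) where
  open DecSetoid D using () renaming (Carrier to A; setoid to S; _≈_ to _∼_; _≟_ to _∼?_; sym to ∼-sym; trans to ∼-trans)

  lookup-injective : ∀ {xs} → AllPairs (λ x y → ¬ (x ∼ y)) xs →
                     ∀ i j → List.lookup xs i ∼ List.lookup xs j → i ≡ j
  lookup-injective (_ ∷ _)  zero    zero    _ = refl
  lookup-injective (x≁ ∷ _) zero    (suc j) e = contradiction e (All.lookup x≁ (∈-lookup j))
  lookup-injective (x≁ ∷ _) (suc i) zero    e = contradiction (∼-sym e) (All.lookup x≁ (∈-lookup i))
  lookup-injective (_ ∷ u)  (suc i) (suc j) e = cong suc (lookup-injective u i j e)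

  enumerated⇒finite : ∀ {xs} → IsEnumeration S xs → Finite S
  enumerated⇒finite {xs} xs-enum = List.length ys , record
    { to        = to
    ; from      = List.lookup ys
    ; to-cong   = λ {x} {y} x∼y → injective _ _ (∼-trans (∼-sym (at x)) (∼-trans x∼y (at y)))
    ; from-cong = λ { refl → DecSetoid.refl D }
    ; inverse   = (λ {i} {x} x∼i → injective _ _ (∼-trans (∼-sym (at x)) x∼i))
                , (λ { {x} refl → ∼-sym (at x) })
    }
    where
    ys : List A
    ys = deduplicate _∼?_ xs

    ys-enum : IsEnumeration S ys
    ys-enum = Enumerates.deduplicate⁺ D xs-enum

    injective : ∀ i j → List.lookup ys i ∼ List.lookup ys j → i ≡ j
    injective = lookup-injective (deduplicate-! D xs)

    to : A → Fin (List.length ys)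
    to x = Any.index (ys-enum x)

    at : ∀ x → x ∼ List.lookup ys (to x)
    at x = lookup-index (ys-enum x)

families : ∀ k {A : Fin k → Set} → (∀ t → List (A t)) → List (∀ t → A t)
families zero    xs = (λ ()) ∷ []
families (suc k) {A} xs = cartesianProductWith cons (xs zero) (families k (xs ∘ suc))
  where
  cons : A zero → (∀ t → A (suc t)) → ∀ t → A t
  cons x f zero    = x
  cons x f (suc t) = f t

families-complete : ∀ k {A : Fin k → Set} (R : ∀ t → A t → A t → Set) {xs : ∀ t → List (A t)} →
                    (∀ t x → Any (R t x) (xs t)) →
                    ∀ (f : ∀ t → A t) → Any (λ g → ∀ t → R t (f t) (g t)) (families k xs)
families-complete zero    R complete f = here (λ ())
families-complete (suc k) R complete f =
  cartesianProductWith⁺ _ (λ { r s zero → r ; r s (suc t) → s t })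
    (complete zero (f zero)) (families-complete k (λ t → R (suc t)) (λ t → complete (suc t)) (f ∘ suc))

mapMaybe-complete : ∀ {A B : Set} {P : A → Set} {Q : B → Set} (f : A → Maybe B) →
                    (∀ {a} → P a → Maybe.Any Q (f a)) →
                    ∀ {xs} → Any P xs → Any Q (mapMaybe f xs)
mapMaybe-complete f hit p = mapMaybe⁺ f _ (map⁺ (Any.map hit p))

maps : ∀ n m → List (Fin n → Fin m)
maps n m = families n (λ _ → List.allFin m)

maps-complete : ∀ n {m} (f : Fin n → Fin m) → Any (f ≗_) (maps n m)
maps-complete n = families-complete n (λ _ → _≡_) (λ _ → ∈-allFin)

toPermutation : ∀ {n} → (Fin n → Fin n) × (Fin n → Fin n) → Maybe (Permutation′ n)
toPermutation (f , g) with all? (λ i → f (g i) ≟ i) ×-dec all? (λ i → g (f i) ≟ i)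
... | yes (fg , gf) = just (permutation f g fg gf)
... | no _          = nothing

permutations : ∀ n → List (Permutation′ n)
permutations n = mapMaybe toPermutation (cartesianProduct (maps n n) (maps n n))

permutations-complete : ∀ {n} (π : Permutation′ n) → Any (π ≈_) (permutations n)
permutations-complete {n} π =
  mapMaybe-complete toPermutation hit
    (cartesianProduct⁺ (maps-complete n (π ⟨$⟩ʳ_)) (maps-complete n (π ⟨$⟩ˡ_)))
  where
  hit : ∀ {fg} → ((π ⟨$⟩ʳ_) ≗ proj₁ fg) × ((π ⟨$⟩ˡ_) ≗ proj₂ fg) → Maybe.Any (π ≈_) (toPermutation fg)
  hit {f , g} (ef , eg) with all? (λ i → f (g i) ≟ i) ×-dec all? (λ i → g (f i) ≟ i)
  ... | yes _ = Maybe.just ef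
  ... | no ¬inverse = contradiction
    ( (λ i → trans (sym (ef (g i))) (trans (cong (π ⟨$⟩ʳ_) (sym (eg i))) (inverseʳ π)))
    , (λ i → trans (sym (eg (f i))) (trans (cong (π ⟨$⟩ˡ_) (sym (ef i))) (inverseˡ π)))
    ) ¬inverse

-- Being constant on cycles is decided through its one-step instance.
step⇒cycle-invariant : ∀ {n p} (π : Permutation′ n) (φ : Fin n → Fin p) →
                       (∀ a → φ a ≡ φ (π ⟨$⟩ʳ a)) → ∀ a b → SameCycle π a b → φ a ≡ φ b
step⇒cycle-invariant π φ step a b (zero  , refl) = refl
step⇒cycle-invariant π φ step a b (suc m , eq)   =
  trans (step a) (step⇒cycle-invariant π φ step (π ⟨$⟩ʳ a) b (m , eq))

composite-cong : ∀ {n} k {π ρ : Fin k → Permutation′ n} → (∀ t → π t ≈ ρ t) → composite π ≈ composite ρ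
composite-cong zero    e i = refl
composite-cong (suc k) {ρ = ρ} e i =
  trans (e zero _) (cong (ρ zero ⟨$⟩ʳ_) (composite-cong k (e ∘ suc) i))

module _ {n : ℕ} .{{_ : NonZero n}} {k : ℕ} (γ : Fin k → Composition n) where

  private
    Raw : Set
    Raw = (Fin k → Permutation′ n) × (∀ t → Fin n → Fin (length (γ t)))

    Valid : Raw → Set
    Valid (π , φ) = (∀ i → composite π ⟨$⟩ʳ i ≡ longCycle n i)
                  × (∀ t → StrictlySurjective _≡_ (φ t))
                  × (∀ t a → φ t a ≡ φ t (π t ⟨$⟩ʳ a))
                  × (∀ t i → ∣ preimage (φ t) i ∣ ≡ part (γ t) i)

    valid? : ∀ r → Dec (Valid r)
    valid? (π , φ) = all? (λ i → _ ≟ _)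
               ×-dec all? (λ t → all? λ i → any? λ a → _ ≟ _)
               ×-dec all? (λ t → all? λ a → _ ≟ _)
               ×-dec all? (λ t → all? λ i → _ ℕ.≟ _)

    open DecSetoid (coloredFactorizationsOf γ) using () renaming (Carrier to CF; setoid to S; _≈_ to _∼_)

    raw : CF → Raw
    raw (F , _) = F.π , F.φ
      where module F = ColoredFactorization F

    _≈ᵣ_ : Raw → Raw → Set
    (π , φ) ≈ᵣ (ρ , ψ) = (∀ t → π t ≈ ρ t) × (∀ t → φ t ≗ ψ t)

    valid-resp : ∀ F r → raw F ≈ᵣ r → Valid r
    valid-resp (F , sizes) (ρ , ψ) (e , f) =
        (λ i → trans (sym (composite-cong k e i)) (F.factorizes i))
      , (λ t i → let a , φa≡i = surjective⇒strictlySurjective (F.surjective t) i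
                 in a , trans (sym (f t a)) φa≡i)
      , (λ t a → trans (sym (f t a)) (trans (F.cycle-invariant t a _ (1 , e t a)) (f t _)))
      , (λ t i → trans (cong ∣_∣ (tabulate-cong (λ a → cong (λ x → does (x ≟ i)) (sym (f t a))))) (sizes t i))
      where module F = ColoredFactorization F

    fromRaw : Raw → Maybe CF
    fromRaw (π , φ) with valid? (π , φ)
    ... | no _ = nothing
    ... | yes (factorizes , surjective , step , sizes) = just (record
      { π               = π
      ; φ               = φ
      ; factorizes      = factorizes
      ; surjective      = λ t → strictlySurjective⇒surjective (surjective t)
      ; cycle-invariant = λ t → step⇒cycle-invariant (π t) (φ t) (step t)
      } , sizes)

    fromRaw-hit : ∀ F {r} → raw F ≈ᵣ r → Maybe.Any (F ∼_) (fromRaw r)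
    fromRaw-hit F {r} e with valid? r
    ... | yes _     = Maybe.just e
    ... | no ¬valid = contradiction (valid-resp F r e) ¬valid

    raws : List Raw
    raws = cartesianProduct (families k (λ _ → permutations n))
                            (families k (λ t → maps n (length (γ t))))

    enumeration : IsEnumeration S (mapMaybe fromRaw raws)
    enumeration F = mapMaybe-complete fromRaw (fromRaw-hit F)
      (cartesianProduct⁺
        (families-complete k (λ _ → _≈_) (λ _ → permutations-complete) (proj₁ (raw F)))
        (families-complete k (λ _ → _≗_) (λ _ → maps-complete n) (proj₂ (raw F))))

  coloredFactorizationsOf-finite : Finite (DecSetoid.setoid (coloredFactorizationsOf γ))
  coloredFactorizationsOf-finite = enumerated⇒finite (coloredFactorizationsOf γ) enumeration

  -- The cardinality, up to _≋_, of the colored factorizations with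
  -- color-compositions γ.
  c : ℕ
  c = proj₁ coloredFactorizationsOf-finite

{-# OPTIONS --safe #-}
-- Both sides are compared through the number of pairs of a colored factorization of an arbitrary
-- n-cycle and a bijection g carrying longCycle to that n-cycle: conjugation shows that this multiplies
-- c by n!, and the resulting count is invariant under cyclic rotation of the factors, so that it is
-- enough to change the color-composition γ of a single factor π, the product ρ of the others being
-- fixed. The colorings φ and the bijections g are then counted together. As π ρ is the n-cycle, g is
-- an Eulerian tour of the graph on the colors with an arc φ x → φ (ρ x) for every x. By the BEST
-- theorem the tours starting at color zero are counted by spanning trees, given by the last exits
-- e j from the other colors suc j, times γ₀! ∏ (γⱼ - 1)!. For fixed e, a Cayley-type count shows that the
-- colorings for which e is a tree are as many as the words of content γ - 1, or there are none,
-- depending on ρ and e only. The product of these counts is γ₀ (n - p)! for all γ with p parts, and the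
-- number of tours with any starting point is n / γ₀ times the number of those starting at color zero.
module Submission where

open import Defs
open import Data.Bool as Bool using (Bool; true; false)
open import Data.Fin using (Fin; zero; suc; toℕ; inject₁; fromℕ; _≟_)
open import Data.Fin.Induction using (<-weakInduction)
open import Data.Fin.Permutation using (Permutation′; permutation; _⟨$⟩ʳ_; _⟨$⟩ˡ_; _∘ₚ_; flip; inverseˡ; inverseʳ) renaming (_≈_ to _≈ₚ_; id to idₚ)
open import Data.Fin.Properties using (all?; any?; suc-injective; toℕ-injective; toℕ-fromℕ<; toℕ-fromℕ; toℕ-inject₁; toℕ<n)
open import Data.Fin.Relation.Unary.Top using (view; ‵fromℕ; ‵inject₁)
open import Data.Fin.Subset using (∣_∣)
open import Data.List as List using (List; []; _∷_; _++_; map; filter; cartesianProductWith; cartesianProduct; allFin; concatMap; deduplicate)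
open import Data.List.Membership.DecPropositional using () renaming (_∈?_ to member?)
open import Data.List.Membership.Propositional using (_∈_; find)
open import Data.List.Membership.Propositional.Properties using (∈-allFin; ∈-lookup; ∈-map⁻; ∈-map⁺; ∈-concatMap⁻; ∈-filter⁺; ∈-filter⁻; ∈-++⁺ˡ; ∈-++⁺ʳ; ∈-cartesianProductWith⁻)
open import Data.List.Membership.Propositional.Properties.WithK using (unique∧set⇒bag)
open import Data.List.Properties using (∷-injective; ∷-injectiveʳ; ∷-injectiveˡ; length-tabulate; length-map; length-++; ++-assoc; map-++; map-∘; map-cong; map-tabulate; tabulate-lookup) renaming (≡-dec to ≡ᴸ-dec)
open import Data.List.Relation.Binary.BagAndSetEquality using (∼bag⇒↭)
open import Data.List.Relation.Binary.Permutation.Propositional as Perm using (_↭_; ↭-sym; ↭-refl)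
import Data.List.Relation.Binary.Permutation.Propositional.Properties as ↭
import Data.List.Relation.Binary.Permutation.Setoid.Properties as Permₛ
open import Data.List.Relation.Unary.All as All using (All; []; _∷_)
open import Data.List.Relation.Unary.AllPairs as AllPairs using (AllPairs; []; _∷_)
open import Data.List.Relation.Unary.Any as Any using (Any; here; there)
open import Data.List.Relation.Unary.Enumerates.Setoid using (IsEnumeration)
import Data.List.Relation.Unary.Enumerates.Setoid.Properties as Enumerates
open import Data.List.Relation.Unary.Unique.DecSetoid.Properties using (deduplicate-!)
open import Data.List.Relation.Unary.Unique.Propositional using (Unique)
import Data.List.Relation.Unary.Unique.Propositional.Properties as Unique
open import Data.List.Relation.Unary.Unique.Propositional.Properties using (allFin⁺)
open import Data.Nat as ℕ using (ℕ; zero; suc; _+_; _*_; _∸_; _≤_; _<_; _≥_; z≤n; s≤s; _!; NonZero)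
open import Data.Nat.DivMod using (_%_; m<n⇒m%n≡m; n%n≡0; m%n<n)
open import Data.Nat.ListAction using (sum)
open import Data.Nat.ListAction.Properties using (sum-↭)
open import Data.Nat.Properties hiding (_≟_; suc-injective)
open import Data.Nat.Solver using (module +-*-Solver)
open import Data.Product using (∃; _×_; _,_; proj₁; proj₂; map₂)
open import Data.Sum using (_⊎_; inj₁; inj₂)
open import Data.Unit using (⊤; tt)
import Data.Vec as Vec
open import Function using (Inverse; _∘_; id)
open import Function.Bundles using (mk⇔)
open import Function.Consequences.Propositional using (strictlySurjective⇒surjective)
open import Level using (0ℓ)
open import Relation.Binary using (DecSetoid)
open import Relation.Binary.Definitions using (DecidableEquality)
open import Relation.Binary.PropositionalEquality
open import Relation.Nullary using (¬_; Dec; yes; no; does; contradiction; ¬?)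
open import Relation.Nullary.Decidable using (_×-dec_; _→-dec_; map′)
open import Relation.Unary using (Decidable)

-- The long cycle gives way to an arbitrary n-cycle because moving a factor from one end of a
-- product to the other conjugates the product: equality with one fixed cycle does not survive this,
-- being conjugate to it does. With `ρ` and `g` given, the remaining factor is forced to be
-- `g L g⁻¹ ρ⁻¹`, where `L` is the long cycle, and constancy of `φ` on its cycles becomes
-- `φ (g (L i)) ≡ φ (ρ (g i))`, in which the factor no longer occurs; this is where the tours come
-- from. The number of spanning trees depends on the coloring and not only on its content, so no
-- coloring can be treated alone. After the sums are exchanged, the content enters for fixed exits
-- only through a multinomial coefficient, whose denominator `∏ (γᵤ - 1)!` is cancelled by the BEST
-- weight `γ₀ ∏ (γᵤ - 1)!`. The root color zero is an arbitrary choice; its trace `γ₀` disappears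
-- with the passage to any starting point. Ratios are never formed: each is an equation between
-- products, followed by cancellation of a positive factor.

private variable
  A B : Set
  P Q : Set

-- Finite sums over lists

𝟙 : Dec P → ℕ
𝟙 (yes _) = 1
𝟙 (no _)  = 0

𝟙-cong : (P → Q) → (Q → P) → (P? : Dec P) (Q? : Dec Q) → 𝟙 P? ≡ 𝟙 Q?
𝟙-cong f g (yes p) (yes q) = refl
𝟙-cong f g (yes p) (no ¬q) = contradiction (f p) ¬q
𝟙-cong f g (no ¬p) (yes q) = contradiction (g q) ¬p
𝟙-cong f g (no ¬p) (no ¬q) = refl

𝟙-yes : (P? : Dec P) → P → 𝟙 P? ≡ 1
𝟙-yes (yes _) p = refl
𝟙-yes (no ¬p) p = contradiction p ¬p

𝟙-no : (P? : Dec P) → ¬ P → 𝟙 P? ≡ 0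
𝟙-no (yes p) ¬p = contradiction p ¬p
𝟙-no (no _)  ¬p = refl

𝟙-× : (P? : Dec P) (Q? : Dec Q) → 𝟙 (P? ×-dec Q?) ≡ 𝟙 P? * 𝟙 Q?
𝟙-× (yes p) (yes q) = refl
𝟙-× (yes p) (no q)  = refl
𝟙-× (no p)  Q?      = refl

𝟙-guard : (P? : Dec P) {m n : ℕ} → (P → m ≡ n) → 𝟙 P? * m ≡ 𝟙 P? * n
𝟙-guard (yes p) f = cong (1 *_) (f p)
𝟙-guard (no _)  f = refl

∑ : List A → (A → ℕ) → ℕ
∑ xs f = sum (map f xs)

syntax ∑ xs (λ x → e) = ∑[ x ← xs ] e

∑-cong∈ : ∀ (xs : List A) {f g : A → ℕ} → (∀ {x} → x ∈ xs → f x ≡ g x) → ∑ xs f ≡ ∑ xs g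
∑-cong∈ []       e = refl
∑-cong∈ (x ∷ xs) e = cong₂ _+_ (e (here refl)) (∑-cong∈ xs (e ∘ there))

∑-cong : ∀ (xs : List A) {f g : A → ℕ} → (∀ x → f x ≡ g x) → ∑ xs f ≡ ∑ xs g
∑-cong xs e = ∑-cong∈ xs (λ {x} _ → e x)

∑-zero : ∀ (xs : List A) → ∑ xs (λ _ → 0) ≡ 0
∑-zero []       = refl
∑-zero (x ∷ xs) = ∑-zero xs

∑-one : ∀ (xs : List A) → ∑ xs (λ _ → 1) ≡ List.length xs
∑-one []       = refl
∑-one (x ∷ xs) = cong suc (∑-one xs)

∑-+ : ∀ (xs : List A) (f g : A → ℕ) → ∑[ x ← xs ] (f x + g x) ≡ ∑ xs f + ∑ xs g
∑-+ []       f g = refl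
∑-+ (x ∷ xs) f g = trans (cong (f x + g x +_) (∑-+ xs f g))
  (solve 4 (λ a b c d → a :+ b :+ (c :+ d) := a :+ c :+ (b :+ d)) refl (f x) (g x) (∑ xs f) (∑ xs g))
  where open +-*-Solver

∑-*ˡ : ∀ (xs : List A) a (f : A → ℕ) → ∑[ x ← xs ] (a * f x) ≡ a * ∑ xs f
∑-*ˡ []       a f = sym (*-zeroʳ a)
∑-*ˡ (x ∷ xs) a f = trans (cong (a * f x +_) (∑-*ˡ xs a f)) (sym (*-distribˡ-+ a (f x) _))

∑-*ʳ : ∀ (xs : List A) a (f : A → ℕ) → ∑[ x ← xs ] (f x * a) ≡ ∑ xs f * a
∑-*ʳ xs a f = trans (∑-cong xs (λ x → *-comm (f x) a)) (trans (∑-*ˡ xs a f) (*-comm a _))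

∑-swap : ∀ (xs : List A) (ys : List B) (f : A → B → ℕ) →
         ∑[ x ← xs ] ∑[ y ← ys ] f x y ≡ ∑[ y ← ys ] ∑[ x ← xs ] f x y
∑-swap []       ys f = sym (∑-zero ys)
∑-swap (x ∷ xs) ys f = trans (cong (∑ ys (f x) +_) (∑-swap xs ys f)) (sym (∑-+ ys _ _))

∑-map : ∀ (xs : List A) (t : A → B) (f : B → ℕ) → ∑ (map t xs) f ≡ ∑ xs (f ∘ t)
∑-map []       t f = refl
∑-map (x ∷ xs) t f = cong (f (t x) +_) (∑-map xs t f)

∑-++ : ∀ (xs ys : List A) (f : A → ℕ) → ∑ (xs ++ ys) f ≡ ∑ xs f + ∑ ys f
∑-++ []       ys f = refl
∑-++ (x ∷ xs) ys f = trans (cong (f x +_) (∑-++ xs ys f)) (sym (+-assoc (f x) _ _))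

∑-↭ : ∀ {xs ys : List A} (f : A → ℕ) → xs ↭ ys → ∑ xs f ≡ ∑ ys f
∑-↭ f p = sum-↭ (↭.map⁺ f p)

∑-filter : ∀ {P : A → Set} (P? : Decidable P) xs (f : A → ℕ) →
           ∑ (filter P? xs) f ≡ ∑[ x ← xs ] (𝟙 (P? x) * f x)
∑-filter P? []       f = refl
∑-filter P? (x ∷ xs) f with P? x
... | yes _ = cong₂ _+_ (sym (*-identityˡ (f x))) (∑-filter P? xs f)
... | no _  = ∑-filter P? xs f

∑-cartesianProductWith : ∀ {C : Set} (t : A → B → C) xs ys (f : C → ℕ) →
  ∑ (cartesianProductWith t xs ys) f ≡ ∑[ x ← xs ] ∑[ y ← ys ] f (t x y)
∑-cartesianProductWith t []       ys f = refl
∑-cartesianProductWith t (x ∷ xs) ys f =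
  trans (∑-++ (map (t x) ys) _ f) (cong₂ _+_ (∑-map ys (t x) f) (∑-cartesianProductWith t xs ys f))

∑-none : ∀ {P : A → Set} (P? : Decidable P) {xs} → All (λ x → ¬ P x) xs → ∑ xs (𝟙 ∘ P?) ≡ 0
∑-none P? []         = refl
∑-none P? (¬p ∷ ¬ps) = cong₂ _+_ (𝟙-no (P? _) ¬p) (∑-none P? ¬ps)

∑-exactlyOne : ∀ {P : A → Set} (P? : Decidable P) {xs} →
  AllPairs (λ x y → ¬ (P x × P y)) xs → Any P xs → ∑ xs (𝟙 ∘ P?) ≡ 1
∑-exactlyOne P? (u ∷ us) (here px) = cong₂ _+_ (𝟙-yes (P? _) px) (∑-none P? (All.map (λ ¬pq py → ¬pq (px , py)) u))
∑-exactlyOne P? (u ∷ us) (there p) =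
  cong₂ _+_ (𝟙-no (P? _) (λ px → let ¬pq , py = All.lookupAny u p in ¬pq (px , py))) (∑-exactlyOne P? us p)

∑-delta : ∀ {P : A → Set} (P? : Decidable P) {xs} (f : A → ℕ) {c} →
  AllPairs (λ x y → ¬ (P x × P y)) xs → Any P xs → (∀ x → P x → f x ≡ c) →
  ∑[ x ← xs ] (𝟙 (P? x) * f x) ≡ c
∑-delta P? {xs} f {c} u a e = trans (∑-cong xs λ x → 𝟙-guard (P? x) (e x))
  (trans (∑-*ʳ xs c _) (trans (cong (_* c) (∑-exactlyOne P? u a)) (*-identityˡ c)))

-- Both sides count the matched pairs.
∑-match : ∀ {R : A → B → Set} (R? : ∀ x y → Dec (R x y)) xs ys (f : A → ℕ) (g : B → ℕ) →
  (∀ {x y} → R x y → f x ≡ g y) →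
  (∀ {x} → x ∈ xs → ∑[ y ← ys ] 𝟙 (R? x y) ≡ 1) →
  (∀ {y} → y ∈ ys → ∑[ x ← xs ] 𝟙 (R? x y) ≡ 1) →
  ∑ xs f ≡ ∑ ys g
∑-match R? xs ys f g e one₁ one₂ = begin
  ∑ xs f                                       ≡⟨ ∑-cong∈ xs (λ {x} x∈ → sym (trans (∑-*ʳ ys (f x) _) (trans (cong (_* f x) (one₁ x∈)) (*-identityˡ _)))) ⟩
  ∑[ x ← xs ] ∑[ y ← ys ] (𝟙 (R? x y) * f x)   ≡⟨ ∑-cong xs (λ x → ∑-cong ys λ y → 𝟙-guard (R? x y) e) ⟩
  ∑[ x ← xs ] ∑[ y ← ys ] (𝟙 (R? x y) * g y)   ≡⟨ ∑-swap xs ys _ ⟩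
  ∑[ y ← ys ] ∑[ x ← xs ] (𝟙 (R? x y) * g y)   ≡⟨ ∑-cong∈ ys (λ {y} y∈ → trans (∑-*ʳ xs (g y) _) (trans (cong (_* g y) (one₂ y∈)) (*-identityˡ _))) ⟩
  ∑ ys g                                       ∎
  where open ≡-Reasoning

∏ : ∀ {p} → (Fin p → ℕ) → ℕ
∏ {zero}  f = 1
∏ {suc p} f = f zero * ∏ (f ∘ suc)

∏-cong : ∀ {p} {f g : Fin p → ℕ} → (∀ u → f u ≡ g u) → ∏ f ≡ ∏ g
∏-cong {zero}  e = refl
∏-cong {suc p} e = cong₂ _*_ (e zero) (∏-cong (e ∘ suc))

∏-one : ∀ {p} {f : Fin p → ℕ} → (∀ u → f u ≡ 1) → ∏ f ≡ 1
∏-one {zero}  e = refl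
∏-one {suc p} e = cong₂ _*_ (e zero) (∏-one (e ∘ suc))

∏-update : ∀ {p} (f g : Fin p → ℕ) i d → f i ≡ d * g i → (∀ u → u ≢ i → f u ≡ g u) → ∏ f ≡ d * ∏ g
∏-update f g zero    d e o = trans (cong₂ _*_ e (∏-cong λ u → o (suc u) λ ())) (*-assoc d _ _)
∏-update f g (suc i) d e o = trans
  (cong₂ _*_ (o zero λ ()) (∏-update (f ∘ suc) (g ∘ suc) i d e (λ u u≢i → o (suc u) (u≢i ∘ suc-injective))))
  (solve 3 (λ a b c → a :* (b :* c) := b :* (a :* c)) refl (g zero) d (∏ (g ∘ suc)))
  where open +-*-Solver

∑-concatMap : ∀ (t : A → List B) xs (f : B → ℕ) → ∑ (concatMap t xs) f ≡ ∑[ x ← xs ] ∑ (t x) f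
∑-concatMap t []       f = refl
∑-concatMap t (x ∷ xs) f = trans (∑-++ (t x) _ f) (cong (∑ (t x) f +_) (∑-concatMap t xs f))

-- Enumeration of the orderings of a list

select : List A → List (A × List A)
select []       = []
select (x ∷ xs) = (x , xs) ∷ map (map₂ (x ∷_)) (select xs)

select-↭ : ∀ {xs : List A} {x ys} → (x , ys) ∈ select xs → xs ↭ x ∷ ys
select-↭ {xs = x ∷ xs} (here refl) = ↭-refl
select-↭ {xs = x ∷ xs} (there p) with ∈-map⁻ _ p
... | (y , ys) , q , refl = Perm.trans (Perm.prep x (select-↭ q)) (Perm.swap x y ↭-refl)

∑-select : ∀ (xs : List A) (f : A → ℕ) → ∑[ s ← select xs ] f (proj₁ s) ≡ ∑ xs f
∑-select []       f = refl
∑-select (x ∷ xs) f = cong (f x +_) (trans (∑-map (select xs) _ _) (∑-select xs f))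

-- Meaningful only if k is the length of the list.
orders : ℕ → List A → List (List A)
orders zero    xs = [] ∷ []
orders (suc k) xs = concatMap (λ (x , ys) → map (x ∷_) (orders k ys)) (select xs)

∑-orders : ∀ k (xs : List A) f →
  ∑ (orders (suc k) xs) f ≡ ∑[ s ← select xs ] ∑[ l ← orders k (proj₂ s) ] f (proj₁ s ∷ l)
∑-orders k xs f = trans (∑-concatMap _ (select xs) f)
  (∑-cong (select xs) λ (x , ys) → ∑-map (orders k ys) (x ∷_) f)

length-↭∷ : ∀ {xs : List A} {x ys k} → xs ↭ x ∷ ys → List.length xs ≡ suc k → List.length ys ≡ k
length-↭∷ p e = cong ℕ.pred (trans (sym (↭.↭-length p)) e)

orders-↭ : ∀ k {xs l : List A} → List.length xs ≡ k → l ∈ orders k xs → l ↭ xs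
orders-↭ zero {[]}  e (here refl) = ↭-refl
orders-↭ (suc k) {xs} e p with find (∈-concatMap⁻ (λ (x , ys) → map (x ∷_) (orders k ys)) {xs = select xs} p)
... | (x , ys) , s , q with ∈-map⁻ _ q
... | l , r , refl = Perm.trans (Perm.prep x (orders-↭ k (length-↭∷ (select-↭ s) e) r)) (↭-sym (select-↭ s))

Unique-resp-↭ : ∀ {xs ys : List A} → xs ↭ ys → Unique xs → Unique ys
Unique-resp-↭ p = Permₛ.Unique-resp-↭ (setoid _) (Perm.↭⇒↭ₛ p)

∑-unique : ∀ (_≟ᴬ_ : DecidableEquality A) {xs : List A} {y} → Unique xs → y ∈ xs → ∑[ x ← xs ] 𝟙 (x ≟ᴬ y) ≡ 1
∑-unique _≟ᴬ_ {y = y} u y∈ = ∑-exactlyOne (_≟ᴬ y) (AllPairs.map (λ x≢z (e , f) → x≢z (trans e (sym f))) u) (Any.map sym y∈)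

-- Since `xs` has no repetitions, a single selection exposes the head of `ys`; the tail is then an
-- ordering of what that selection leaves.
orders-one : ∀ (_≟ᴬ_ : DecidableEquality A) k {xs ys : List A} → Unique xs → List.length xs ≡ k → ys ↭ xs →
             ∑[ l ← orders k xs ] 𝟙 (≡ᴸ-dec _≟ᴬ_ l ys) ≡ 1
orders-one _≟ᴬ_ zero {[]} {ys} u e p rewrite ↭.↭-empty-inv p = refl
orders-one _≟ᴬ_ (suc k) {xs} {[]} u e p = contradiction (trans (↭.↭-length p) e) λ ()
orders-one _≟ᴬ_ (suc k) {xs} {y ∷ ys} u e p = begin
  ∑[ l ← orders (suc k) xs ] 𝟙 (≡ᴸ-dec _≟ᴬ_ l (y ∷ ys))
    ≡⟨ ∑-orders k xs _ ⟩
  ∑[ s ← select xs ] ∑[ l ← orders k (proj₂ s) ] 𝟙 (≡ᴸ-dec _≟ᴬ_ (proj₁ s ∷ l) (y ∷ ys))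
    ≡⟨ ∑-cong∈ (select xs) (λ { {x , zs} s∈ → trans
         (∑-cong (orders k zs) λ l → trans
           (𝟙-cong ∷-injective (λ (a , b) → cong₂ _∷_ a b) _ (x ≟ᴬ y ×-dec ≡ᴸ-dec _≟ᴬ_ l ys))
           (𝟙-× (x ≟ᴬ y) _))
         (trans (∑-*ˡ (orders k zs) (𝟙 (x ≟ᴬ y)) _)
         (trans (𝟙-guard (x ≟ᴬ y) {n = 1} λ { refl → orders-one _≟ᴬ_ k
             (AllPairs.tail (Unique-resp-↭ (select-↭ s∈) u)) (length-↭∷ (select-↭ s∈) e)
             (↭.drop-∷ (Perm.trans p (select-↭ s∈))) })
           (*-identityʳ _))) }) ⟩
  ∑[ s ← select xs ] 𝟙 (proj₁ s ≟ᴬ y)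
    ≡⟨ ∑-select xs (λ x → 𝟙 (x ≟ᴬ y)) ⟩
  ∑[ x ← xs ] 𝟙 (x ≟ᴬ y)
    ≡⟨ ∑-unique _≟ᴬ_ u (↭.∈-resp-↭ p (here refl)) ⟩
  1 ∎
  where open ≡-Reasoning

-- The BEST theorem

-- A division-free average: the summand at `x` is the share `a x / D` of `w`, and the shares add up
-- to one. In the tour count `a` marks the arcs that may come first and `D` is their number.
average : ∀ (xs : List A) (f a : A → ℕ) D w .{{_ : NonZero D}} →
          (∀ {x} → x ∈ xs → D * f x ≡ a x * w) → ∑ xs a ≡ D → ∑ xs f ≡ w
average xs f a D w e s = *-cancelˡ-≡ _ _ D (begin
  D * ∑ xs f                ≡⟨ ∑-*ˡ xs D f ⟨
  ∑[ x ← xs ] (D * f x)     ≡⟨ ∑-cong∈ xs e ⟩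
  ∑[ x ← xs ] (a x * w)     ≡⟨ ∑-*ʳ xs w a ⟩
  ∑ xs a * w                ≡⟨ cong (_* w) s ⟩
  D * w                     ∎)
  where open ≡-Reasoning

-- `P` gives the parent of each nonzero color. It is a spanning tree directed towards `zero` exactly
-- when all colors have a derivation, since an inductive derivation rules out cycles of parents.
data Reach {q} (P : Fin q → Fin (suc q)) : Fin (suc q) → Set where
  root : Reach P zero
  step : ∀ j → Reach P (P j) → Reach P (suc j)

-- The number of orders of d exits from a color, with the last one prescribed except at the root.
ω : ∀ {q} → Fin (suc q) → ℕ → ℕ
ω zero    d = d !
ω (suc _) d = (d ∸ 1) !

module Tours {n q} (φ : Fin n → Fin (suc q)) (ρ : Fin n → Fin n) where

  out inn : Fin (suc q) → List (Fin n) → ℕ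
  out u S = ∑[ x ← S ] 𝟙 (φ x ≟ u)
  inn u S = ∑[ x ← S ] 𝟙 (φ (ρ x) ≟ u)

  out-present : ∀ {u} S → 0 < out u S → ∃ λ x → x ∈ S × φ x ≡ u
  out-present {u} (x ∷ S) o with φ x ≟ u
  ... | yes e = x , here refl , e
  ... | no _  = let y , y∈ , e = out-present S o in y , there y∈ , e

  present-out : ∀ {u x S} → x ∈ S → φ x ≡ u → 0 < out u S
  present-out {u} {x} {.x ∷ S} (here refl) e rewrite 𝟙-yes (φ x ≟ u) e = s≤s z≤n
  present-out {u} {x} {y ∷ S} (there i) e = ≤-trans (present-out i e) (m≤n+m _ (𝟙 (φ y ≟ u)))

  present-inn : ∀ {u x S} → x ∈ S → φ (ρ x) ≡ u → 0 < inn u S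
  present-inn {u} {x} {.x ∷ S} (here refl) e rewrite 𝟙-yes (φ (ρ x) ≟ u) e = s≤s z≤n
  present-inn {u} {x} {y ∷ S} (there i) e = ≤-trans (present-inn i e) (m≤n+m _ (𝟙 (φ (ρ y) ≟ u)))

  -- An element x is seen as an arc from φ x to φ (ρ x).
  Path : Fin (suc q) → List (Fin n) → Set
  Path v []      = v ≡ zero
  Path v (x ∷ l) = φ x ≡ v × Path (φ (ρ x)) l

  path? : ∀ v l → Dec (Path v l)
  path? v []      = v ≟ zero
  path? v (x ∷ l) = (φ x ≟ v) ×-dec path? (φ (ρ x)) l

  Exit : Fin q → Fin n → Fin n → List (Fin n) → Set
  Exit j y x l = φ x ≡ suc j → (x ≡ y → out (suc j) l ≡ 0) × (out (suc j) l ≡ 0 → x ≡ y)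

  exit? : ∀ j y x l → Dec (Exit j y x l)
  exit? j y x l = (φ x ≟ suc j) →-dec (((x ≟ y) →-dec (out (suc j) l ℕ.≟ 0)) ×-dec ((out (suc j) l ℕ.≟ 0) →-dec (x ≟ y)))

  LastExit : Fin q → Fin n → List (Fin n) → Set
  LastExit j y []      = ⊤
  LastExit j y (x ∷ l) = Exit j y x l × LastExit j y l

  lastExit? : ∀ j y l → Dec (LastExit j y l)
  lastExit? j y []      = yes tt
  lastExit? j y (x ∷ l) = exit? j y x l ×-dec lastExit? j y l

  LastExits : (Fin q → Fin n) → List (Fin n) → Set
  LastExits e l = ∀ j → LastExit j (e j) l

  Exits : (Fin q → Fin n) → Fin n → List (Fin n) → Set
  Exits e x l = ∀ j → Exit j (e j) x l

  exits? : ∀ e x l → Dec (Exits e x l)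
  exits? e x l = all? λ j → exit? j (e j) x l

  lastExits? : ∀ e l → Dec (LastExits e l)
  lastExits? e l = all? λ j → lastExit? j (e j) l

  out-↭ : ∀ u {S S′} → S ↭ S′ → out u S ≡ out u S′
  out-↭ u = ∑-↭ _

  tour? : ∀ e v l → Dec (Path v l × LastExits e l)
  tour? e v l = path? v l ×-dec lastExits? e l

  tours : (Fin q → Fin n) → ℕ → Fin (suc q) → List (Fin n) → ℕ
  tours e k v S = ∑[ l ← orders k S ] 𝟙 (tour? e v l)

  exit-cong : ∀ {j y x} l l′ → out (suc j) l ≡ out (suc j) l′ → Exit j y x l → Exit j y x l′
  exit-cong l l′ o ex c = (λ h → trans (sym o) (proj₁ (ex c) h)) , (λ h → proj₂ (ex c) (trans o h))

  -- What is required of the first arc depends only on which arcs remain, not on their order, so it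
  -- factors out of the sum over the orders of the rest.
  tours-suc : ∀ e k v S → List.length S ≡ suc k →
    tours e (suc k) v S ≡
    ∑[ s ← select S ] (𝟙 ((φ (proj₁ s) ≟ v) ×-dec exits? e (proj₁ s) (proj₂ s)) * tours e k (φ (ρ (proj₁ s))) (proj₂ s))
  tours-suc e k v S len = trans (∑-orders k S _) (∑-cong∈ (select S) λ { {x , S′} s∈ → trans
    (∑-cong∈ (orders k S′) λ {l} l∈ →
      let o = λ j → out-↭ (suc j) (orders-↭ k (length-↭∷ (select-↭ s∈) len) l∈) in trans
      (𝟙-cong (λ ((a , p) , le) → (a , λ j → exit-cong l S′ (o j) (proj₁ (le j))) , (p , proj₂ ∘ le))
              (λ ((a , ex) , (p , le)) → (a , p) , (λ j → exit-cong S′ l (sym (o j)) (ex j) , le j))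
              (tour? e v (x ∷ l)) (((φ x ≟ v) ×-dec exits? e x S′) ×-dec tour? e (φ (ρ x)) l))
      (𝟙-× ((φ x ≟ v) ×-dec exits? e x S′) _))
    (∑-*ˡ (orders k S′) (𝟙 ((φ x ≟ v) ×-dec exits? e x S′)) _) })

  -- Induction from the end of the tour. If `x` is the last exit from its color, the parent is the
  -- color that the tour enters next, which reaches the root by induction; otherwise the same color
  -- is left again later.
  tour-reaches : ∀ e v l → Path v l → LastExits e l → let R = Reach (φ ∘ ρ ∘ e) in
                 R v × (∀ {x} → x ∈ l → R (φ x))
  tour-reaches e v [] refl le = root , λ ()
  tour-reaches e v (x ∷ l) (refl , p) le with tour-reaches e (φ (ρ x)) l p (proj₂ ∘ le)
  ... | r , rs = rv , λ { (here refl) → rv ; (there i) → rs i }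
    where
    rv : Reach (φ ∘ ρ ∘ e) (φ x)
    rv with φ x in eq
    ... | zero = root
    ... | suc j with out (suc j) l in eqo
    ... | zero = step j (subst (Reach _ ∘ φ ∘ ρ) (proj₂ (proj₁ (le j) refl) eqo) r)
    ... | suc _ with y , y∈ , ey ← out-present {suc j} l (subst (0 <_) (sym eqo) (s≤s z≤n)) = subst (Reach _) ey (rs y∈)

  weight : List (Fin n) → ℕ
  weight S = ∏ (λ u → ω u (out u S))

  weight-step : ∀ {S x S′} d → S ↭ x ∷ S′ → ω (φ x) (suc (out (φ x) S′)) ≡ d * ω (φ x) (out (φ x) S′) →
                weight S ≡ d * weight S′
  weight-step {S} {x} {S′} d p e = ∏-update _ _ (φ x) d
    (trans (cong (ω (φ x)) (trans (out-↭ (φ x) p) (cong (_+ out (φ x) S′) (𝟙-yes (φ x ≟ φ x) refl)))) e)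
    (λ u u≢ → cong (ω u) (trans (out-↭ u p) (cong (_+ out u S′) (𝟙-no (φ x ≟ u) (u≢ ∘ sym)))))

  -- Euler's condition for a walk from `v` to the root: out-degree minus in-degree is `+1` at `v`
  -- and `-1` at `zero`, moved across the equation to avoid subtraction.
  Balanced : Fin (suc q) → List (Fin n) → Set
  Balanced v S = ∀ u → out u S + 𝟙 (u ≟ zero) ≡ inn u S + 𝟙 (u ≟ v)

  balanced-step : ∀ {S x S′} → S ↭ x ∷ S′ → Balanced (φ x) S → Balanced (φ (ρ x)) S′
  balanced-step {S} {x} {S′} p b u = +-cancelˡ-≡ (𝟙 (φ x ≟ u)) _ _ (begin
    𝟙 (φ x ≟ u) + (out u S′ + 𝟙 (u ≟ zero))                ≡⟨ +-assoc (𝟙 (φ x ≟ u)) _ _ ⟨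
    𝟙 (φ x ≟ u) + out u S′ + 𝟙 (u ≟ zero)                  ≡⟨ cong (_+ 𝟙 (u ≟ zero)) (out-↭ u p) ⟨
    out u S + 𝟙 (u ≟ zero)                                 ≡⟨ b u ⟩
    inn u S + 𝟙 (u ≟ φ x)                                  ≡⟨ cong₂ _+_ (∑-↭ _ p) (𝟙-cong sym sym (u ≟ φ x) (φ x ≟ u)) ⟩
    𝟙 (φ (ρ x) ≟ u) + inn u S′ + 𝟙 (φ x ≟ u)               ≡⟨ solve 3 (λ a b c → a :+ b :+ c := c :+ (b :+ a)) refl (𝟙 (φ (ρ x) ≟ u)) (inn u S′) (𝟙 (φ x ≟ u)) ⟩
    𝟙 (φ x ≟ u) + (inn u S′ + 𝟙 (φ (ρ x) ≟ u))             ≡⟨ cong (λ a → 𝟙 (φ x ≟ u) + (inn u S′ + a)) (𝟙-cong sym sym (φ (ρ x) ≟ u) (u ≟ φ (ρ x))) ⟩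
    𝟙 (φ x ≟ u) + (inn u S′ + 𝟙 (u ≟ φ (ρ x)))             ∎)
    where open ≡-Reasoning
          open +-*-Solver

  module _ (e : Fin q → Fin n) (φe : ∀ j → φ (e j) ≡ suc j) (reach : ∀ j → Reach (φ ∘ ρ ∘ e) (suc j)) where

    Marked : List (Fin n) → Set
    Marked S = ∀ j → 0 < out (suc j) S → e j ∈ S

    inn≡out : ∀ S → Balanced zero S → ∀ v → inn v S ≡ out v S
    inn≡out S b v = sym (+-cancelʳ-≡ (𝟙 (v ≟ zero)) _ _ (b v))

    inn-root : ∀ S → Balanced zero S → Marked S → ∀ {v} → Reach (φ ∘ ρ ∘ e) v → 0 < inn v S → 0 < inn zero S
    inn-root S b m root       o = o
    inn-root S b m (step j r) o = inn-root S b m r (present-inn (m j (subst (0 <_) (inn≡out S b (suc j)) o)) refl)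

    out-root : ∀ x S → x ∈ S → Balanced zero S → Marked S → 0 < out zero S
    out-root x S x∈ b m with φ x in eq
    ... | zero  = present-out x∈ eq
    ... | suc j = subst (0 <_) (inn≡out S b zero)
      (inn-root S b m (reach j) (subst (0 <_) (sym (inn≡out S b (suc j))) (present-out x∈ eq)))

    tours-weight : ∀ k v S → List.length S ≡ k → Unique S → Marked S → Balanced v S → tours e k v S ≡ weight S
    tours-weight zero v [] len us m b with v ≟ zero
    ... | no v≢0 = contradiction (trans (b zero) (𝟙-no (zero ≟ v) (v≢0 ∘ sym))) λ ()
    ... | yes refl = trans (cong (_+ 0) (𝟙-yes (tour? e zero []) (refl , λ _ → tt))) (sym (∏-one {f = λ u → ω {q} u 0} λ { zero → refl ; (suc _) → refl }))
    tours-weight (suc k) v S len us m b = trans (tours-suc e k v S len) (go v _ refl refl)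
      where
      next : ∀ {x S′} → (x , S′) ∈ select S → φ x ≡ v → Exits e x S′ → tours e k (φ (ρ x)) S′ ≡ weight S′
      next {x} {S′} s∈ refl ex = tours-weight k (φ (ρ x)) S′ (length-↭∷ p len)
        (AllPairs.tail (Unique-resp-↭ p us)) marked (balanced-step p b)
        where
        p = select-↭ s∈
        marked : Marked S′
        marked j o with ↭.∈-resp-↭ p (m j (subst (0 <_) (sym (out-↭ (suc j) p)) (≤-trans o (m≤n+m _ (𝟙 (φ x ≟ suc j))))))
        ... | there i = i
        ... | here refl = contradiction (proj₁ (ex j (φe j)) refl) (m<n⇒n≢0 o)
      term : Fin n × List (Fin n) → ℕ
      term (x , S′) = 𝟙 ((φ x ≟ v) ×-dec exits? e x S′) * tours e k (φ (ρ x)) S′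

      hit : ∀ {x S′} → (x , S′) ∈ select S → φ x ≡ v → Exits e x S′ → term (x , S′) ≡ weight S′
      hit {x} {S′} s∈ c ex = trans (cong (_* _) (𝟙-yes ((φ x ≟ v) ×-dec exits? e x S′) (c , ex)))
        (trans (*-identityˡ _) (next s∈ c ex))

      miss : ∀ {x S′} → ¬ (φ x ≡ v × Exits e x S′) → term (x , S′) ≡ 0
      miss {x} {S′} ¬ce = cong (_* _) (𝟙-no ((φ x ≟ v) ×-dec exits? e x S′) ¬ce)

      out-rest : ∀ {x S′ d} → (x , S′) ∈ select S → φ x ≡ v → out v S ≡ suc d → out v S′ ≡ d
      out-rest {x} {S′} s∈ c o = cong ℕ.pred
        (trans (cong (_+ out v S′) (sym (𝟙-yes (φ x ≟ v) c))) (trans (sym (out-↭ v (select-↭ s∈))) o))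

      weight-rest : ∀ {x S′ d} → (x , S′) ∈ select S → φ x ≡ v → out v S ≡ suc d →
                    ∀ m → ω v (suc d) ≡ m * ω v d → weight S ≡ m * weight S′
      weight-rest {x} s∈ refl o m w = weight-step m (select-↭ s∈)
        (subst (λ d → ω v (suc d) ≡ m * ω v d) (sym (out-rest s∈ refl o)) w)

      exits-color : ∀ {x S′ j} → φ x ≡ suc j →
                    (x ≡ e j → out (suc j) S′ ≡ 0) → (out (suc j) S′ ≡ 0 → x ≡ e j) → Exits e x S′
      exits-color c f g i c′ with refl ← trans (sym c) c′ = f , g

      value : ∀ {x S′} {Q : Set} (Q? : Dec Q) D → (x , S′) ∈ select S →
              (φ x ≡ v × Exits e x S′ → Q) → (Q → φ x ≡ v × Exits e x S′) → (Q → weight S ≡ D * weight S′) →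
              D * term (x , S′) ≡ 𝟙 Q? * weight S
      value (yes q) D s∈ f g w = trans (cong (D *_) (hit s∈ (proj₁ (g q)) (proj₂ (g q)))) (trans (sym (w q)) (sym (*-identityˡ _)))
      value {x} {S′} (no ¬q) D s∈ f g w = trans (cong (D *_) (miss {x} {S′} (¬q ∘ f))) (*-zeroʳ D)

      go : ∀ u d → u ≡ v → out u S ≡ d → ∑ (select S) term ≡ weight S
      -- A walk stuck at the root with arcs left over: the tree would bring one of them back to the
      -- root.
      go zero zero refl o = contradiction o (m<n⇒n≢0 (out-root _ S (proj₂ (nonempty S len)) b m))
        where
        nonempty : ∀ (S : List (Fin n)) {k} → List.length S ≡ suc k → ∃ (_∈ S)
        nonempty (x ∷ _) _ = x , here refl
      go zero (suc d) refl o = average (select S) term (λ (x , _) → 𝟙 (φ x ≟ zero)) (suc d) (weight S)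
        (λ { {x , S′} s∈ → value (φ x ≟ zero) (suc d) s∈ proj₁
             (λ c → c , λ j c′ → contradiction (trans (sym c) c′) λ ())
             (λ c → weight-rest s∈ c o (suc d) refl) })
        (trans (∑-select S (λ x → 𝟙 (φ x ≟ zero))) o)
      -- The walk cannot get stuck away from the root: balance at the current color demands one more
      -- exit than entries.
      go (suc j) zero refl o = contradiction (trans (trans (b (suc j)) (cong (inn (suc j) S +_) (𝟙-yes (suc j ≟ suc j) refl))) (+-comm _ 1))
        (λ h → contradiction (trans (sym h) (trans (+-identityʳ _) o)) λ ())
      -- The only exit left is the marked one. The weight does not change, since `ω` is 1 both at 1
      -- and, by truncated subtraction, at 0.
      go (suc j) (suc zero) refl o = average (select S) term (λ (x , _) → 𝟙 (φ x ≟ suc j)) 1 (weight S)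
        (λ { {x , S′} s∈ → value (φ x ≟ suc j) 1 s∈ proj₁
             (λ c → let o′ = out-rest s∈ c o in
               c , exits-color {S′ = S′} c (λ _ → o′) λ _ → last s∈ o′)
             (λ c → weight-rest s∈ c o 1 refl) })
        (trans (∑-select S (λ x → 𝟙 (φ x ≟ suc j))) o)
        where
        last : ∀ {x S′} → (x , S′) ∈ select S → out (suc j) S′ ≡ 0 → x ≡ e j
        last s∈ o′ with ↭.∈-resp-↭ (select-↭ s∈) (m j (subst (0 <_) (sym o) (s≤s z≤n)))
        ... | here eq = sym eq
        ... | there i = contradiction o′ (m<n⇒n≢0 (present-out i (φe j)))
      -- The marked exit must wait, so `suc d` of the `suc (suc d)` exits may come next.
      go (suc j) (suc (suc d)) refl o = average (select S) term (λ (x , _) → 𝟙 ((φ x ≟ suc j) ×-dec ¬? (x ≟ e j))) (suc d) (weight S)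
        (λ { {x , S′} s∈ → value ((φ x ≟ suc j) ×-dec ¬? (x ≟ e j)) (suc d) s∈
             (λ (c , ex) → c , λ eq → contradiction (trans (sym (proj₁ (ex j c) eq)) (out-rest s∈ c o)) λ ())
             (λ (c , ne) → c , exits-color {S′ = S′} c (λ eq → contradiction eq ne)
                                 (λ h → contradiction (trans (sym h) (out-rest s∈ c o)) λ ()))
             (λ (c , ne) → weight-rest s∈ c o (suc d) refl) })
        (trans (∑-select S (λ x → 𝟙 ((φ x ≟ suc j) ×-dec ¬? (x ≟ e j)))) others)
        where
        others : ∑[ x ← S ] 𝟙 ((φ x ≟ suc j) ×-dec ¬? (x ≟ e j)) ≡ suc d
        others = +-cancelʳ-≡ 1 _ _ (begin
          ∑[ x ← S ] 𝟙 ((φ x ≟ suc j) ×-dec ¬? (x ≟ e j)) + 1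
            ≡⟨ cong (∑[ x ← S ] 𝟙 ((φ x ≟ suc j) ×-dec ¬? (x ≟ e j)) +_) (∑-unique _≟_ us (m j (subst (0 <_) (sym o) (s≤s z≤n)))) ⟨
          ∑[ x ← S ] 𝟙 ((φ x ≟ suc j) ×-dec ¬? (x ≟ e j)) + ∑[ x ← S ] 𝟙 (x ≟ e j)
            ≡⟨ ∑-+ S _ _ ⟨
          ∑[ x ← S ] (𝟙 ((φ x ≟ suc j) ×-dec ¬? (x ≟ e j)) + 𝟙 (x ≟ e j))
            ≡⟨ ∑-cong S split ⟩
          out (suc j) S ≡⟨ o ⟩
          suc (suc d)   ≡⟨ +-comm 1 (suc d) ⟩
          suc d + 1     ∎)
          where
          open ≡-Reasoning
          split : ∀ x → 𝟙 ((φ x ≟ suc j) ×-dec ¬? (x ≟ e j)) + 𝟙 (x ≟ e j) ≡ 𝟙 (φ x ≟ suc j)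
          split x = trans (cong (_+ 𝟙 (x ≟ e j)) (𝟙-× (φ x ≟ suc j) (¬? (x ≟ e j)))) (lem (φ x ≟ suc j) (x ≟ e j))
            where
            lem : (c : Dec (φ x ≡ suc j)) (E : Dec (x ≡ e j)) → 𝟙 c * 𝟙 (¬? E) + 𝟙 E ≡ 𝟙 c
            lem (yes _) (yes _)    = refl
            lem (yes _) (no _)     = refl
            lem (no ¬c) (yes refl) = contradiction (φe j) ¬c
            lem (no ¬c) (no _)     = refl

-- Sums over functions and permutations up to pointwise equality

module Enumerated (D : DecSetoid 0ℓ 0ℓ) {xs} (xs-enum : IsEnumeration (DecSetoid.setoid D) xs) where
  open DecSetoid D using (Carrier; _≈_; setoid) renaming (_≟_ to _≈?_; sym to ≈-sym; trans to ≈-trans; refl to ≈-refl)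

  elements : List Carrier
  elements = deduplicate _≈?_ xs

  elements-one : ∀ {P : Carrier → Set} (P? : Decidable P) x →
                 (∀ {y} → x ≈ y → P y) → (∀ {y} → P y → x ≈ y) → ∑ elements (𝟙 ∘ P?) ≡ 1
  elements-one P? x x-sat x-only = ∑-exactlyOne P?
    (AllPairs.map (λ y≉z (p , p′) → y≉z (≈-trans (≈-sym (x-only p)) (x-only p′))) (deduplicate-! D xs))
    (Any.map x-sat (Enumerates.deduplicate⁺ D xs-enum x))

  -- The entries are mere representatives, so `t` permutes their classes and not the list itself;
  -- hence the matching up to equivalence and the condition that `f` respects it.
  elements-reindex : ∀ (t t⁻ : Carrier → Carrier) → (∀ {x y} → x ≈ y → t x ≈ t y) → (∀ {x y} → x ≈ y → t⁻ x ≈ t⁻ y) →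
    (∀ x → t (t⁻ x) ≈ x) → (∀ x → t⁻ (t x) ≈ x) →
    ∀ (f : Carrier → ℕ) → (∀ {x y} → x ≈ y → f x ≡ f y) → ∑ elements (f ∘ t) ≡ ∑ elements f
  elements-reindex t t⁻ t-cong t⁻-cong tt⁻ t⁻t f f-cong = ∑-match (λ x y → t x ≈? y) elements elements (f ∘ t) f f-cong
    (λ {x} _ → elements-one (λ y → t x ≈? y) (t x) id id)
    (λ {y} _ → elements-one (λ x → t x ≈? y) (t⁻ y) (λ e → ≈-trans (t-cong (≈-sym e)) (tt⁻ y)) (λ e → ≈-trans (t⁻-cong (≈-sym e)) (t⁻t _)))

functions : ℕ → ℕ → DecSetoid 0ℓ 0ℓ
functions n m = record
  { Carrier = Fin n → Fin m
  ; _≈_ = _≗_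
  ; isDecEquivalence = record
    { isEquivalence = record
      { refl = λ _ → refl ; sym = λ e i → sym (e i) ; trans = λ e f i → trans (e i) (f i) }
    ; _≟_ = λ f g → all? λ i → f i ≟ g i
    }
  }

module Functions (n m : ℕ) = Enumerated (functions n m) (maps-complete n)

fns : ∀ n m → List (Fin n → Fin m)
fns n m = Functions.elements n m

fns-one : ∀ {n m} {P : (Fin n → Fin m) → Set} (P? : Decidable P) (f : Fin n → Fin m) →
          (∀ {g} → f ≗ g → P g) → (∀ {g} → P g → f ≗ g) → ∑ (fns n m) (𝟙 ∘ P?) ≡ 1
fns-one = Functions.elements-one _ _

-- Trees as acyclic parent maps

merge : ∀ {q} → Fin q → Fin (suc q) → Fin (suc q) → Fin (suc q)
merge j t v with v ≟ suc j
... | yes _ = t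
... | no _  = v

merge-miss : ∀ {q} (j : Fin q) t {v} → v ≢ suc j → merge j t v ≡ v
merge-miss j t {v} ne with v ≟ suc j
... | yes e = contradiction e ne
... | no _  = refl

-- Union-find: D maps a color to the representative of its class, and P is the parent map.
Acyclic : ∀ {q} → (Fin (suc q) → Fin (suc q)) → List (Fin q) → (Fin q → Fin (suc q)) → Set
Acyclic D []       P = ⊤
Acyclic D (j ∷ js) P = D (P j) ≢ suc j × Acyclic (merge j (D (P j)) ∘ D) js P

acyclic? : ∀ {q} D js (P : Fin q → Fin (suc q)) → Dec (Acyclic D js P)
acyclic? D []       P = yes tt
acyclic? D (j ∷ js) P = ¬? (D (P j) ≟ suc j) ×-dec acyclic? (merge j (D (P j)) ∘ D) js P

-- `Reach` at an intermediate stage of the elimination: `D` has identified some colors, and only the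
-- nodes in `js` still have their parent edge.
data ReachIn {q} (D : Fin (suc q) → Fin (suc q)) (js : List (Fin q)) (P : Fin q → Fin (suc q)) : Fin (suc q) → Set where
  root : ReachIn D js P zero
  step : ∀ {j} → j ∈ js → ReachIn D js P (D (P j)) → ReachIn D js P (suc j)

module _ {q} {D : Fin (suc q) → Fin (suc q)} {j : Fin q} {js : List (Fin q)} {P : Fin q → Fin (suc q)} where

  private
    t = D (P j)
    D′ = merge j t ∘ D

  -- Infinite descent: a derivation at `suc j` contains a smaller one at its parent's
  -- representative, which is `suc j` again.
  no-loop : t ≡ suc j → ∀ {v} → ReachIn D (j ∷ js) P v → v ≢ suc j
  no-loop l (step i r) refl = no-loop l r l

  -- Once `suc j` and the representative `t` of its parent are identified, a step at `j` goes
  -- nowhere and is dropped. `t` differs from `suc j`, so the merge leaves `t` in place.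
  contract : ∀ {v} → t ≢ suc j → ReachIn D (j ∷ js) P v → ReachIn D′ js P (merge j t v)
  contract ne root = root
  contract ne (step {i} i∈ r) with suc i ≟ suc j
  ... | yes refl = subst (ReachIn D′ js P) (merge-miss j t ne) (contract ne r)
  contract ne (step (here refl) r) | no i≢j = contradiction refl i≢j
  contract ne (step (there i∈) r)  | no i≢j = step i∈ (contract ne r)

  unmerge : ∀ {u v} → merge j t u ≡ v → ReachIn D (j ∷ js) P v → ReachIn D (j ∷ js) P u
  unmerge {u} e r with u ≟ suc j
  ... | yes refl = step (here refl) (subst (ReachIn D (j ∷ js) P) (sym e) r)
  ... | no _     = subst (ReachIn D (j ∷ js) P) (sym e) r

  expand : ∀ {v} → ReachIn D′ js P v → ReachIn D (j ∷ js) P v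
  expand root        = root
  expand (step i∈ r) = step (there i∈) (unmerge refl (expand r))

-- Invariant of the elimination: a class other than that of the root is represented by a node still
-- to be processed. When no node is left, everything lies in the root's class.
Into : ∀ {q} → (Fin (suc q) → Fin (suc q)) → List (Fin q) → Set
Into D js = ∀ c → D c ≡ zero ⊎ ∃ λ j → j ∈ js × D c ≡ suc j

into-merge : ∀ {q} D (j : Fin q) js {t} → t ≢ suc j → t ≡ zero ⊎ (∃ λ i → i ∈ j ∷ js × t ≡ suc i) →
             Into D (j ∷ js) → Into (merge j t ∘ D) js
into-merge D j js {t} ne tcase inv c with D c ≟ suc j | inv c
... | no _   | inj₁ e                    = inj₁ e
... | no ¬e  | inj₂ (i , here refl , e)  = contradiction e ¬e
... | no _   | inj₂ (i , there i∈ , e)   = inj₂ (i , i∈ , e)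
... | yes _  | _ with tcase
... | inj₁ e                   = inj₁ e
... | inj₂ (i , here refl , e) = contradiction e ne
... | inj₂ (i , there i∈ , e)  = inj₂ (i , i∈ , e)

acyclic⇒reach : ∀ {q} D js {P : Fin q → Fin (suc q)} → Into D js →
                Acyclic D js P → ∀ {j} → j ∈ js → ReachIn D js P (suc j)
acyclic⇒reach D (j ∷ js) {P} inv (ne , ac) = all
  where
  below : ∀ {i} → i ∈ js → ReachIn D (j ∷ js) P (suc i)
  below i∈ = expand (acyclic⇒reach (merge j (D (P j)) ∘ D) js (into-merge D j js ne (inv (P j)) inv) ac i∈)
  target : ∀ {v} → v ≢ suc j → v ≡ zero ⊎ (∃ λ i → i ∈ j ∷ js × v ≡ suc i) → ReachIn D (j ∷ js) P v
  target _  (inj₁ refl)                   = root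
  target ne (inj₂ (i , here refl , refl)) = contradiction refl ne
  target _  (inj₂ (i , there i∈ , refl))  = below i∈
  all : ∀ {i} → i ∈ j ∷ js → ReachIn D (j ∷ js) P (suc i)
  all (there i∈)  = below i∈
  all (here refl) = step (here refl) (target ne (inv (P j)))

reach⇒acyclic : ∀ {q} D js {P : Fin q → Fin (suc q)} → Unique js →
                (∀ {j} → j ∈ js → ReachIn D js P (suc j)) → Acyclic D js P
reach⇒acyclic D []       u r = tt
reach⇒acyclic D (j ∷ js) {P} (j∉ ∷ u) r = ne , reach⇒acyclic _ js u λ {i} i∈ →
  subst (ReachIn _ js P) (merge-miss j _ λ e → All.lookup j∉ i∈ (sym (suc-injective e))) (contract ne (r (there i∈)))
  where
  ne : D (P j) ≢ suc j
  ne l = no-loop l (r (here refl)) refl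

module _ {q} {js : List (Fin q)} (all-js : ∀ j → j ∈ js) (js-unique : Unique js) {P : Fin q → Fin (suc q)} where

  -- The order of elimination is free. Later this allows the nodes whose parent is forced to be
  -- eliminated before those whose parent may still vary.
  tree⇒acyclic : (∀ j → Reach P (suc j)) → Acyclic id js P
  tree⇒acyclic r = reach⇒acyclic id js js-unique (λ {j} _ → to (r j))
    where
    to : ∀ {v} → Reach P v → ReachIn id js P v
    to root       = root
    to (step j r) = step (all-js j) (to r)

  acyclic⇒tree : Acyclic id js P → ∀ j → Reach P (suc j)
  acyclic⇒tree ac j = from (acyclic⇒reach id js into ac (all-js j))
    where
    into : Into id js
    into zero    = inj₁ refl
    into (suc j) = inj₂ (j , all-js j , refl)
    from : ∀ {v} → ReachIn id js P v → Reach P v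
    from root       = root
    from (step _ r) = step _ (from r)

-- A derivation of `Reach` is not found by a bounded search as it stands; union-find replaces it by
-- finitely many comparisons.
tree? : ∀ {q} (P : Fin q → Fin (suc q)) → Dec (∀ j → Reach P (suc j))
tree? {q} P = map′ (acyclic⇒tree ∈-allFin (allFin⁺ q)) (tree⇒acyclic ∈-allFin (allFin⁺ q)) (acyclic? id (allFin q) P)

-- Closed tours classified by their last exits

module _ {n q} (φ : Fin n → Fin (suc q)) (ρ : Fin n → Fin n) where
  open Tours φ ρ

  lastExit-exists : ∀ j l → Unique l → 0 < out (suc j) l → ∃ λ y → y ∈ l × φ y ≡ suc j × LastExit j y l
  lastExit-exists j (x ∷ l) (x∉ ∷ u) o with out (suc j) l ℕ.≟ 0
  ... | no ne =
    let y , y∈ , c , le = lastExit-exists j l u (n≢0⇒n>0 ne) in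
    y , there y∈ , c , (λ _ → (λ { refl → contradiction refl (All.lookup x∉ y∈) }) , (λ h → contradiction h ne)) , le
  ... | yes eq = x , here refl , colored , (λ _ → (λ _ → eq) , λ _ → refl) , absent l eq
    where
    colored : φ x ≡ suc j
    colored with φ x ≟ suc j
    ... | yes e = e
    ... | no _  = contradiction eq (m<n⇒n≢0 o)
    absent : ∀ l → out (suc j) l ≡ 0 → LastExit j x l
    absent []      _ = tt
    absent (z ∷ l) h = (λ c → contradiction h (m<n⇒n≢0 (present-out {S = z ∷ l} (here refl) c))) , absent l (m+n≡0⇒n≡0 (𝟙 (φ z ≟ suc j)) h)

  lastExit-unique : ∀ j l {y y′} → 0 < out (suc j) l → LastExit j y l → LastExit j y′ l → y ≡ y′
  lastExit-unique j (x ∷ l) o (h , t) (h′ , t′) with out (suc j) l ℕ.≟ 0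
  ... | no ne = lastExit-unique j l (n≢0⇒n>0 ne) t t′
  ... | yes eq with φ x ≟ suc j
  ... | yes c = trans (sym (proj₂ (h c) eq)) (proj₂ (h′ c) eq)
  ... | no _  = contradiction eq (m<n⇒n≢0 o)

  -- This inserts a sum over `e` into the count of tours. Each color has to be left at least once,
  -- as the condition is vacuous at a color that is never left and would not determine `e` there.
  lastExits-one : ∀ l → Unique l → (∀ j → 0 < out (suc j) l) →
                  ∑[ e ← fns q n ] 𝟙 (all? (λ j → φ (e j) ≟ suc j) ×-dec lastExits? e l) ≡ 1
  lastExits-one l u o = fns-one _ (λ j → proj₁ (ex j))
    (λ f≗g → (λ j → trans (cong φ (sym (f≗g j))) (proj₁ (proj₂ (proj₂ (ex j)))))
           , (λ j → subst (λ y → LastExit j y l) (f≗g j) (proj₂ (proj₂ (proj₂ (ex j))))))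
    (λ (_ , le) j → lastExit-unique j l (o j) (proj₂ (proj₂ (proj₂ (ex j)))) (le j))
    where
    ex : ∀ j → ∃ λ y → y ∈ l × φ y ≡ suc j × LastExit j y l
    ex j = lastExit-exists j l u (o j)

  -- Last exits that do not form a tree belong to no tour by `tour-reaches`; those that do belong to
  -- `weight` many by `tours-weight`, whatever the tree is.
  closed-tours : (∀ u → out u (allFin n) ≡ inn u (allFin n)) → (∀ j → 0 < out (suc j) (allFin n)) →
    ∑[ l ← orders n (allFin n) ] 𝟙 (path? zero l) ≡
    ∑[ e ← fns q n ] (𝟙 (all? λ j → φ (e j) ≟ suc j) * (𝟙 (tree? (φ ∘ ρ ∘ e)) * weight (allFin n)))
  closed-tours bal occ = begin
    ∑[ l ← orders n V ] 𝟙 (path? zero l)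
      ≡⟨ ∑-cong∈ (orders n V) (λ {l} l∈ → let p = orders-↭ n len l∈ in sym (trans (∑-*ʳ (fns q n) (𝟙 (path? zero l)) _) (trans (cong (_* 𝟙 (path? zero l))
           (lastExits-one l (Unique-resp-↭ (↭-sym p) (allFin⁺ n)) λ j → subst (0 <_) (sym (out-↭ (suc j) p)) (occ j))) (*-identityˡ _)))) ⟩
    ∑[ l ← orders n V ] ∑[ e ← fns q n ] (𝟙 (colored? e ×-dec lastExits? e l) * 𝟙 (path? zero l))
      ≡⟨ ∑-swap (orders n V) (fns q n) _ ⟩
    ∑[ e ← fns q n ] ∑[ l ← orders n V ] (𝟙 (colored? e ×-dec lastExits? e l) * 𝟙 (path? zero l))
      ≡⟨ ∑-cong (fns q n) (λ e → ∑-cong (orders n V) λ l → regroup e l) ⟩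
    ∑[ e ← fns q n ] ∑[ l ← orders n V ] (𝟙 (colored? e) * 𝟙 (tour? e zero l))
      ≡⟨ ∑-cong (fns q n) (λ e → ∑-*ˡ (orders n V) (𝟙 (colored? e)) _) ⟩
    ∑[ e ← fns q n ] (𝟙 (colored? e) * tours e n zero V)
      ≡⟨ ∑-cong (fns q n) (λ e → 𝟙-guard (colored? e) (count e)) ⟩
    ∑[ e ← fns q n ] (𝟙 (colored? e) * (𝟙 (tree? (φ ∘ ρ ∘ e)) * weight V)) ∎
    where
    open ≡-Reasoning
    V = allFin n
    len : List.length V ≡ n
    len = length-tabulate id
    colored? : ∀ (e : Fin q → Fin n) → Dec (∀ j → φ (e j) ≡ suc j)
    colored? e = all? λ j → φ (e j) ≟ suc j
    regroup : ∀ e l → 𝟙 (colored? e ×-dec lastExits? e l) * 𝟙 (path? zero l) ≡ 𝟙 (colored? e) * 𝟙 (tour? e zero l)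
    regroup e l rewrite 𝟙-× (colored? e) (lastExits? e l) | 𝟙-× (path? zero l) (lastExits? e l) =
      solve 3 (λ a b c → a :* b :* c := a :* (c :* b)) refl (𝟙 (colored? e)) (𝟙 (lastExits? e l)) (𝟙 (path? zero l))
      where open +-*-Solver
    count : ∀ e → (∀ j → φ (e j) ≡ suc j) → tours e n zero V ≡ 𝟙 (tree? (φ ∘ ρ ∘ e)) * weight V
    count e φe with tree? (φ ∘ ρ ∘ e)
    ... | yes reach = trans (tours-weight e φe reach n zero V len (allFin⁺ n) (λ j _ → ∈-allFin (e j)) (λ u → cong (_+ 𝟙 (u ≟ zero)) (bal u))) (sym (*-identityˡ _))
    ... | no ¬reach = trans (∑-cong∈ (orders n V) λ {l} l∈ → 𝟙-no (tour? e zero l) λ (p , le) →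
      ¬reach λ j → subst (Reach _) (φe j) (proj₂ (tour-reaches e zero l p le) (↭.∈-resp-↭ (↭-sym (orders-↭ n len l∈)) (∈-allFin (e j)))))
      (∑-zero (orders n V))

-- Counting colorings with a prescribed tree of last exits

words : ∀ p → ℕ → List (List (Fin p))
words p zero    = [] ∷ []
words p (suc k) = cartesianProductWith _∷_ (allFin p) (words p k)

∑-words : ∀ p k f → ∑ (words p (suc k)) f ≡ ∑[ i ← allFin p ] ∑[ w ← words p k ] f (i ∷ w)
∑-words p k f = ∑-cartesianProductWith _∷_ (allFin p) (words p k) f

Symmetric : ∀ {p} → (List (Fin p) → ℕ) → Set
Symmetric Φ = ∀ {w w′} → w ↭ w′ → Φ w ≡ Φ w′

-- Junk if the word is shorter than the list of nodes.
AcyclicW : ∀ {q} → (Fin (suc q) → Fin (suc q)) → List (Fin q) → List (Fin (suc q)) → Set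
AcyclicW D []       w       = ⊤
AcyclicW D (j ∷ js) []      = ⊤
AcyclicW D (j ∷ js) (i ∷ w) = D i ≢ suc j × AcyclicW (merge j (D i) ∘ D) js w

acyclicW? : ∀ {q} D js (w : List (Fin (suc q))) → Dec (AcyclicW D js w)
acyclicW? D []       w       = yes tt
acyclicW? D (j ∷ js) []      = yes tt
acyclicW? D (j ∷ js) (i ∷ w) = ¬? (D i ≟ suc j) ×-dec acyclicW? (merge j (D i) ∘ D) js w

acyclic⇒word : ∀ {q} D js {P : Fin q → Fin (suc q)} w → Acyclic D js P → AcyclicW D js (map P js ++ w)
acyclic⇒word D []       w a        = tt
acyclic⇒word D (j ∷ js) w (ne , a) = ne , acyclic⇒word _ js w a

word⇒acyclic : ∀ {q} D js {P : Fin q → Fin (suc q)} w → AcyclicW D js (map P js ++ w) → Acyclic D js P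
word⇒acyclic D []       w a        = tt
word⇒acyclic D (j ∷ js) w (ne , a) = ne , word⇒acyclic _ js w a

-- After `j` is attached to `s`, the letter `t` is in the root's class if it was there before, or if
-- it was in the class of `j` and `s` is the root.
merge-root : ∀ {q} (j : Fin q) (s t : Fin (suc q)) →
  𝟙 (¬? (s ≟ suc j)) * 𝟙 (merge j s t ≟ zero) ≡
  𝟙 (¬? (s ≟ suc j)) * 𝟙 (t ≟ zero) + 𝟙 (s ≟ zero) * 𝟙 (t ≟ suc j)
merge-root j s t with t ≟ suc j
... | no ne = sym (trans (cong (𝟙 (¬? (s ≟ suc j)) * 𝟙 (t ≟ zero) +_) (*-zeroʳ (𝟙 (s ≟ zero)))) (+-identityʳ _))
... | yes refl = trans (lem (s ≟ suc j) (s ≟ zero)) (cong (_+ 𝟙 (s ≟ zero) * 1) (sym (*-zeroʳ (𝟙 (¬? (s ≟ suc j))))))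
  where
  lem : (a : Dec (s ≡ suc j)) (b : Dec (s ≡ zero)) → 𝟙 (¬? a) * 𝟙 b ≡ 𝟙 b * 1
  lem (yes refl) (no _)  = refl
  lem (no _) (yes _) = refl
  lem (no _) (no _)  = refl

𝟙-¬ : ∀ {P : Set} (P? : Dec P) → 𝟙 (¬? P?) + 𝟙 P? ≡ 1
𝟙-¬ (yes _) = refl
𝟙-¬ (no _)  = refl

-- By `merge-root` the constraint splits into `x` outside the class of `j` with `y` at the root, and
-- `x` at the root with `y` in the class of `j`. Symmetry of `H` exchanges the letters in the second
-- case, and the two cases together leave `x` free.
root-letter : ∀ {q} (D : Fin (suc q) → Fin (suc q)) (j : Fin q) (H : Fin (suc q) → Fin (suc q) → ℕ) → (∀ x y → H x y ≡ H y x) →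
  let C = allFin (suc q) in
  ∑[ x ← C ] ∑[ y ← C ] (𝟙 (¬? (D x ≟ suc j)) * 𝟙 (merge j (D x) (D y) ≟ zero) * H x y) ≡
  ∑[ x ← C ] ∑[ y ← C ] (𝟙 (D y ≟ zero) * H x y)
root-letter {q} D j H H-sym = begin
  ∑[ x ← C ] ∑[ y ← C ] (𝟙 (¬? (D x ≟ suc j)) * 𝟙 (merge j (D x) (D y) ≟ zero) * H x y)
    ≡⟨ ∑-cong C (λ x → trans
         (∑-cong C λ y → trans (cong (_* H x y) (merge-root j (D x) (D y))) (*-distribʳ-+ (H x y) (a x * z y) (z x * b y)))
         (∑-+ C (λ y → a x * z y * H x y) (λ y → z x * b y * H x y))) ⟩
  ∑[ x ← C ] (AZ x + ∑[ y ← C ] (z x * b y * H x y))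
    ≡⟨ ∑-+ C AZ (λ x → ∑[ y ← C ] (z x * b y * H x y)) ⟩
  ∑ C AZ + ∑[ x ← C ] ∑[ y ← C ] (z x * b y * H x y)
    ≡⟨ cong (∑ C AZ +_) (∑-swap C C (λ x y → z x * b y * H x y)) ⟩
  ∑ C AZ + ∑[ y ← C ] ∑[ x ← C ] (z x * b y * H x y)
    ≡⟨ cong (∑ C AZ +_) (∑-cong C λ x → ∑-cong C λ y → cong₂ _*_ (*-comm (z y) (b x)) (H-sym y x)) ⟩
  ∑ C AZ + ∑ C BZ
    ≡⟨ ∑-+ C AZ BZ ⟨
  ∑[ x ← C ] (AZ x + BZ x)
    ≡⟨ ∑-cong C (λ x → trans (sym (∑-+ C (λ y → a x * z y * H x y) (λ y → b x * z y * H x y))) (∑-cong C λ y → collect x y)) ⟩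
  ∑[ x ← C ] ∑[ y ← C ] (𝟙 (D y ≟ zero) * H x y) ∎
  where
  open ≡-Reasoning
  C = allFin (suc q)
  a b z AZ BZ : Fin (suc q) → ℕ
  a x = 𝟙 (¬? (D x ≟ suc j))
  b x = 𝟙 (D x ≟ suc j)
  z x = 𝟙 (D x ≟ zero)
  AZ x = ∑[ y ← C ] (a x * z y * H x y)
  BZ x = ∑[ y ← C ] (b x * z y * H x y)
  collect : ∀ x y → a x * z y * H x y + b x * z y * H x y ≡ z y * H x y
  collect x y = trans (solve 4 (λ a b z h → a :* z :* h :+ b :* z :* h := (a :+ b) :* (z :* h)) refl (a x) (b x) (z y) (H x y))
    (trans (cong (_* (z y * H x y)) (𝟙-¬ (D x ≟ suc j))) (*-identityˡ _))
    where open +-*-Solver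

-- Eliminating a node trades the constraint on its letter for one on the next letter, so that in the
-- end a single letter is constrained, to lie in the class of the root.
acyclic-words : ∀ {q} js D k (Φ : List (Fin (suc q)) → ℕ) → Symmetric Φ → Into D js → List.length js ≤ suc k →
  ∑[ w ← words (suc q) (suc k) ] (𝟙 (acyclicW? D js w) * Φ w) ≡
  ∑[ b ← words (suc q) k ] ∑[ i ← allFin (suc q) ] (𝟙 (D i ≟ zero) * Φ (i ∷ b))
acyclic-words {q} [] D k Φ Φ-sym into len = trans (∑-words (suc q) k _)
  (trans (∑-swap C (words (suc q) k) _) (∑-cong (words (suc q) k) λ b → ∑-cong C λ i → cong (_* Φ (i ∷ b)) (sym (𝟙-yes (D i ≟ zero) (zeroD i)))))
  where
  C = allFin (suc q)
  zeroD : ∀ i → D i ≡ zero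
  zeroD i with into i
  ... | inj₁ e = e
acyclic-words {q} (j ∷ []) D zero Φ Φ-sym into len = trans (∑-words (suc q) 0 _)
  (trans (∑-swap C (words (suc q) 0) (λ i w → 𝟙 (acyclicW? D (j ∷ []) (i ∷ w)) * Φ (i ∷ w))) (∑-cong (words (suc q) 0) λ b → ∑-cong C λ i → cong (_* Φ (i ∷ b)) (𝟙-cong (λ (ne , _) → zeroD i ne) (λ e → (λ e′ → contradiction (trans (sym e) e′) λ ()) , tt) (acyclicW? D (j ∷ []) (i ∷ [])) (D i ≟ zero))))
  where
  C = allFin (suc q)
  zeroD : ∀ i → D i ≢ suc j → D i ≡ zero
  zeroD i ne with into i
  ... | inj₁ e                   = e
  ... | inj₂ (_ , here refl , e) = contradiction e ne
acyclic-words (j ∷ _ ∷ _) D zero Φ Φ-sym into (s≤s ())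
acyclic-words {q} (j ∷ js) D (suc k) Φ Φ-sym into (s≤s len) = begin
  ∑[ w ← words (suc q) (2 + k) ] (𝟙 (acyclicW? D (j ∷ js) w) * Φ w)
    ≡⟨ ∑-words (suc q) (suc k) _ ⟩
  ∑[ x ← C ] ∑[ w ← words (suc q) (suc k) ] (𝟙 (acyclicW? D (j ∷ js) (x ∷ w)) * Φ (x ∷ w))
    ≡⟨ ∑-cong C (λ x → trans (∑-cong (words (suc q) (suc k)) λ w → trans (cong (_* Φ (x ∷ w)) (𝟙-× (¬? (D x ≟ suc j)) (acyclicW? (merge j (D x) ∘ D) js w))) (*-assoc (𝟙 (¬? (D x ≟ suc j))) _ _)) (∑-*ˡ (words (suc q) (suc k)) (𝟙 (¬? (D x ≟ suc j))) _)) ⟩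
  ∑[ x ← C ] (𝟙 (¬? (D x ≟ suc j)) * ∑[ w ← words (suc q) (suc k) ] (𝟙 (acyclicW? (merge j (D x) ∘ D) js w) * Φ (x ∷ w)))
    ≡⟨ ∑-cong C (λ x → 𝟙-guard (¬? (D x ≟ suc j)) λ ne → acyclic-words js (merge j (D x) ∘ D) k (Φ ∘ (x ∷_)) (λ p → Φ-sym (Perm.prep x p)) (into-merge D j js ne (into x) into) len) ⟩
  ∑[ x ← C ] (𝟙 (¬? (D x ≟ suc j)) * ∑[ b ← W ] ∑[ y ← C ] (𝟙 (merge j (D x) (D y) ≟ zero) * Φ (x ∷ y ∷ b)))
    ≡⟨ ∑-cong C (λ x → trans (sym (∑-*ˡ W (𝟙 (¬? (D x ≟ suc j))) _)) (∑-cong W λ b → trans (sym (∑-*ˡ C (𝟙 (¬? (D x ≟ suc j))) _)) (∑-cong C λ y → sym (*-assoc (𝟙 (¬? (D x ≟ suc j))) _ _)))) ⟩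
  ∑[ x ← C ] ∑[ b ← W ] ∑[ y ← C ] (𝟙 (¬? (D x ≟ suc j)) * 𝟙 (merge j (D x) (D y) ≟ zero) * Φ (x ∷ y ∷ b))
    ≡⟨ ∑-swap C W _ ⟩
  ∑[ b ← W ] ∑[ x ← C ] ∑[ y ← C ] (𝟙 (¬? (D x ≟ suc j)) * 𝟙 (merge j (D x) (D y) ≟ zero) * Φ (x ∷ y ∷ b))
    ≡⟨ ∑-cong W (λ b → root-letter D j (λ x y → Φ (x ∷ y ∷ b)) (λ x y → Φ-sym (Perm.swap x y ↭-refl))) ⟩
  ∑[ b ← W ] ∑[ x ← C ] ∑[ y ← C ] (𝟙 (D y ≟ zero) * Φ (x ∷ y ∷ b))
    ≡⟨ ∑-swap C W _ ⟨
  ∑[ x ← C ] ∑[ b ← W ] ∑[ y ← C ] (𝟙 (D y ≟ zero) * Φ (x ∷ y ∷ b))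
    ≡⟨ ∑-cong C (λ x → ∑-cong W λ b → ∑-cong C λ y → cong (𝟙 (D y ≟ zero) *_) (Φ-sym (Perm.swap x y ↭-refl))) ⟩
  ∑[ x ← C ] ∑[ b ← W ] ∑[ y ← C ] (𝟙 (D y ≟ zero) * Φ (y ∷ x ∷ b))
    ≡⟨ ∑-words (suc q) k (λ b → ∑[ y ← C ] (𝟙 (D y ≟ zero) * Φ (y ∷ b))) ⟨
  ∑[ b ← words (suc q) (suc k) ] ∑[ y ← C ] (𝟙 (D y ≟ zero) * Φ (y ∷ b)) ∎
  where
  open ≡-Reasoning
  C = allFin (suc q)
  W = words (suc q) k

unique⇒↭ : ∀ {xs ys : List A} → Unique xs → Unique ys →
           (∀ {x} → x ∈ xs → x ∈ ys) → (∀ {x} → x ∈ ys → x ∈ xs) → xs ↭ ys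
unique⇒↭ u v f g = ∼bag⇒↭ (unique∧set⇒bag u v (mk⇔ f g))

words-length : ∀ p k {w} → w ∈ words p k → List.length w ≡ k
words-length p zero    (here refl) = refl
words-length p (suc k) w∈ with ∈-cartesianProductWith⁻ _∷_ (allFin p) (words p k) w∈
... | i , v , _ , v∈ , refl = cong suc (words-length p k v∈)

words-one : ∀ p k w → List.length w ≡ k → ∑[ v ← words p k ] 𝟙 (≡ᴸ-dec _≟_ w v) ≡ 1
words-one p zero    []      e = refl
words-one p (suc k) (i ∷ w) e = begin
  ∑[ v ← words p (suc k) ] 𝟙 (≡ᴸ-dec _≟_ (i ∷ w) v)
    ≡⟨ ∑-words p k _ ⟩
  ∑[ j ← allFin p ] ∑[ v ← words p k ] 𝟙 (≡ᴸ-dec _≟_ (i ∷ w) (j ∷ v))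
    ≡⟨ ∑-cong (allFin p) (λ j → trans
         (∑-cong (words p k) λ v → trans (𝟙-cong (λ e → sym (∷-injectiveˡ e) , ∷-injectiveʳ e) (λ (a , b) → cong₂ _∷_ (sym a) b) _ (j ≟ i ×-dec ≡ᴸ-dec _≟_ w v)) (𝟙-× (j ≟ i) _))
         (trans (∑-*ˡ (words p k) (𝟙 (j ≟ i)) (λ v → 𝟙 (≡ᴸ-dec _≟_ w v))) (trans (cong (𝟙 (j ≟ i) *_) (words-one p k w (cong ℕ.pred e))) (*-identityʳ _)))) ⟩
  ∑[ j ← allFin p ] 𝟙 (j ≟ i)
    ≡⟨ ∑-unique _≟_ (allFin⁺ p) (∈-allFin i) ⟩
  1 ∎
  where open ≡-Reasoning

assign : ∀ {n p} (d : Fin p) (xs : List (Fin n)) (w : List (Fin p)) → Unique xs → List.length w ≡ List.length xs →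
         ∃ λ (φ : Fin n → Fin p) → map φ xs ≡ w
assign d []       []      u e = (λ _ → d) , refl
assign d (x ∷ xs) (i ∷ w) (x∉ ∷ u) e with assign d xs w u (cong ℕ.pred e)
... | φ , eq = φ′ , cong₂ _∷_ at-x (trans (map-cong∈ xs λ y∈ → off (All.lookup x∉ y∈)) eq)
  where
  φ′ : _ → _
  φ′ y with y ≟ x
  ... | yes _ = i
  ... | no _  = φ y
  at-x : φ′ x ≡ i
  at-x with x ≟ x
  ... | yes _ = refl
  ... | no ne = contradiction refl ne
  off : ∀ {y} → x ≢ y → φ′ y ≡ φ y
  off {y} ne with y ≟ x
  ... | yes e = contradiction (sym e) ne
  ... | no _  = refl
  map-cong∈ : ∀ {f g : Fin _ → Fin _} ys → (∀ {y} → y ∈ ys → f y ≡ g y) → map f ys ≡ map g ys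
  map-cong∈ []       h = refl
  map-cong∈ (y ∷ ys) h = cong₂ _∷_ (h (here refl)) (map-cong∈ ys (h ∘ there))

values-injective : ∀ {n p} {f g : Fin n → Fin p} xs → map f xs ≡ map g xs → ∀ {x} → x ∈ xs → f x ≡ g x
values-injective (x ∷ xs) e (here refl) = ∷-injectiveˡ e
values-injective (x ∷ xs) e (there i)   = values-injective xs (∷-injectiveʳ e) i

fns-values-one : ∀ {n p} (d : Fin p) xs → Unique xs → (∀ (x : Fin n) → x ∈ xs) → ∀ w → List.length w ≡ List.length xs →
                 ∑[ φ ← fns n p ] 𝟙 (≡ᴸ-dec _≟_ (map φ xs) w) ≡ 1
fns-values-one d xs u all w e with assign d xs w u e
... | f , refl = fns-one (λ φ → ≡ᴸ-dec _≟_ (map φ xs) (map f xs)) f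
  (λ f≗g → sym (map-cong f≗g xs)) (λ h x → values-injective xs (sym h) (all x))

-- The nodes in `jf` have parents prescribed by `ptr`, so their elimination is the same for all `P`
-- that agree: it either closes a cycle or ends in one fixed contraction. These parents are never
-- the root, so the root's class remains the singleton `zero`.
contract-chains : ∀ {q} jf {jl} (D : Fin (suc q) → Fin (suc q)) (ptr : Fin q → Fin q) →
  Into D (jf ++ jl) → (∀ i → D i ≡ zero → i ≡ zero) → D zero ≡ zero →
  (∀ P → (∀ {j} → j ∈ jf → P j ≡ suc (ptr j)) → ¬ Acyclic D (jf ++ jl) P) ⊎
  ∃ λ D′ → Into D′ jl × (∀ i → D′ i ≡ zero → i ≡ zero) × D′ zero ≡ zero ×
    (∀ P → (∀ {j} → j ∈ jf → P j ≡ suc (ptr j)) → (Acyclic D (jf ++ jl) P → Acyclic D′ jl P) × (Acyclic D′ jl P → Acyclic D (jf ++ jl) P))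
contract-chains []       D ptr into ker z = inj₂ (D , into , ker , z , λ P agree → id , id)
contract-chains (j ∷ jf) {jl} D ptr into ker z with D (suc (ptr j)) ≟ suc j
... | yes loop = inj₁ λ P agree (ne , _) → ne (trans (cong D (agree (here refl))) loop)
... | no ne with contract-chains jf {jl} (merge j (D (suc (ptr j))) ∘ D) ptr (into-merge D j (jf ++ jl) ne (into (suc (ptr j))) into)
                   ker′ (trans (cong (merge j (D (suc (ptr j)))) z) (merge-miss j (D (suc (ptr j))) λ ()))
  where
  ker′ : ∀ i → merge j (D (suc (ptr j))) (D i) ≡ zero → i ≡ zero
  ker′ i e with D i ≟ suc j
  ... | no _  = ker i e
  ... | yes _ = contradiction (ker _ e) λ ()
... | inj₁ fail = inj₁ λ P agree (_ , a) → fail P (agree ∘ there)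
    (subst (λ t → Acyclic (merge j t ∘ D) (jf ++ jl) P) (cong D (agree (here refl))) a)
... | inj₂ (D′ , into′ , ker′ , z′ , iff) = inj₂ (D′ , into′ , ker′ , z′ , λ P agree →
    (λ (_ , a) → proj₁ (iff P (agree ∘ there)) (subst (λ t → Acyclic (merge j t ∘ D) (jf ++ jl) P) (cong D (agree (here refl))) a)) ,
    (λ a → (λ e → ne (trans (cong D (sym (agree (here refl)))) e)) ,
           subst (λ t → Acyclic (merge j t ∘ D) (jf ++ jl) P) (cong D (sym (agree (here refl)))) (proj₂ (iff P (agree ∘ there)) a)))

module _ {n q} .{{_ : NonZero n}} {ρ : Fin n → Fin n} (ρ-injective : ∀ {x y} → ρ x ≡ ρ y → x ≡ y) (e : Fin q → Fin n) where

  private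
    Colored : (Fin n → Fin (suc q)) → Set
    Colored φ = ∀ j → φ (e j) ≡ suc j

    colored? : ∀ φ → Dec (Colored φ)
    colored? φ = all? λ j → φ (e j) ≟ suc j

    sucs : List (Fin (suc q))
    sucs = map suc (allFin q)

    Trees : (List (Fin (suc q)) → ℕ) → ℕ
    Trees Φ = ∑[ φ ← fns n (suc q) ] (𝟙 (colored? φ) * (𝟙 (tree? (φ ∘ ρ ∘ e)) * Φ (map φ (allFin n))))

    -- The letters of an admissible coloring: each `suc j` from its exit `e j`, one `zero` imposed
    -- by the tree condition, and `n ∸ suc q` free letters.
    Rest : (List (Fin (suc q)) → ℕ) → ℕ
    Rest Φ = ∑[ b ← words (suc q) (n ∸ suc q) ] Φ (sucs ++ zero ∷ b)

    none : (∀ φ → Colored φ → ¬ (∀ j → Reach (φ ∘ ρ ∘ e) (suc j))) → ∀ Φ → Trees Φ ≡ 0 * Rest Φ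
    none ¬tree Φ = trans (∑-cong (fns n (suc q)) λ φ → lem φ (colored? φ)) (∑-zero (fns n (suc q)))
      where
      lem : ∀ φ (C? : Dec (Colored φ)) → 𝟙 C? * (𝟙 (tree? (φ ∘ ρ ∘ e)) * Φ (map φ (allFin n))) ≡ 0
      lem φ (no _)  = refl
      lem φ (yes φe) rewrite 𝟙-no (tree? (φ ∘ ρ ∘ e)) (¬tree φ φe) = refl

    module Injective (e-injective : ∀ {i j} → e i ≡ e j → i ≡ j) where

      -- Here `ρ (e j)` is itself a prescribed exit `e i`, so the parent of `j` is `suc i` for every
      -- admissible coloring.
      Follows : Fin q → Set
      Follows j = ∃ λ i → ρ (e j) ≡ e i

      follows? : Decidable Follows
      follows? j = any? λ i → ρ (e j) ≟ e i

      jf jl : List (Fin q)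
      jf = filter follows? (allFin q)
      jl = filter (¬? ∘ follows?) (allFin q)

      ptr : Fin q → Fin q
      ptr j with follows? j
      ... | yes (i , _) = i
      ... | no _        = j

      ptr-e : ∀ {j} → j ∈ jf → ρ (e j) ≡ e (ptr j)
      ptr-e {j} j∈ with follows? j
      ... | yes (_ , eq) = eq
      ... | no ¬f = contradiction (proj₂ (∈-filter⁻ follows? {xs = allFin q} j∈)) ¬f

      js-all : ∀ j → j ∈ jf ++ jl
      js-all j with follows? j
      ... | yes f = ∈-++⁺ˡ (∈-filter⁺ follows? (∈-allFin j) f)
      ... | no ¬f = ∈-++⁺ʳ jf (∈-filter⁺ (¬? ∘ follows?) (∈-allFin j) ¬f)

      jl-unique : Unique jl
      jl-unique = Unique.filter⁺ (¬? ∘ follows?) (allFin⁺ q)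

      js-unique : Unique (jf ++ jl)
      js-unique = Unique.++⁺ (Unique.filter⁺ follows? (allFin⁺ q)) jl-unique
        λ (f , l) → proj₂ (∈-filter⁻ (¬? ∘ follows?) {xs = allFin q} l) (proj₂ (∈-filter⁻ follows? {xs = allFin q} f))

      -- An enumeration of the domain adapted to `e`: the exits, whose colors are prescribed; then
      -- `ρ (e j)` for the other nodes in the order of `jl`, so that their colors are the parents
      -- read by `AcyclicW`; then the remaining elements.
      E Y Z xs : List (Fin n)
      E = map e (allFin q)
      Y = map (ρ ∘ e) jl
      Z = filter (λ x → ¬? (member? _≟_ x (E ++ Y))) (allFin n)
      xs = E ++ (Y ++ Z)

      EY-unique : Unique (E ++ Y)
      EY-unique = Unique.++⁺ (Unique.map⁺ e-injective (allFin⁺ q)) (Unique.map⁺ (e-injective ∘ ρ-injective) jl-unique) disjoint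
        where
        disjoint : ∀ {x} → ¬ (x ∈ E × x ∈ Y)
        disjoint (x∈E , x∈Y) with ∈-map⁻ e x∈E | ∈-map⁻ (ρ ∘ e) x∈Y
        ... | i , _ , eq | j , j∈ , eq′ = proj₂ (∈-filter⁻ (¬? ∘ follows?) {xs = allFin q} j∈) (i , trans (sym eq′) eq)

      xs′-unique : Unique ((E ++ Y) ++ Z)
      xs′-unique = Unique.++⁺ EY-unique (Unique.filter⁺ _ (allFin⁺ n))
        λ (x∈ , x∈Z) → proj₂ (∈-filter⁻ (λ x → ¬? (member? _≟_ x (E ++ Y))) {xs = allFin n} x∈Z) x∈

      xs-assoc : (E ++ Y) ++ Z ≡ xs
      xs-assoc = ++-assoc E Y Z

      xs-unique : Unique xs
      xs-unique = subst Unique xs-assoc xs′-unique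

      xs-all : ∀ x → x ∈ xs
      xs-all x = subst (x ∈_) xs-assoc all′
        where
        all′ : x ∈ (E ++ Y) ++ Z
        all′ with member? _≟_ x (E ++ Y)
        ... | yes x∈ = ∈-++⁺ˡ x∈
        ... | no x∉  = ∈-++⁺ʳ (E ++ Y) (∈-filter⁺ (λ x → ¬? (member? _≟_ x (E ++ Y))) (∈-allFin x) x∉)

      xs↭ : allFin n ↭ xs
      xs↭ = unique⇒↭ (allFin⁺ n) xs-unique (λ {x} _ → xs-all x) (λ {x} _ → ∈-allFin x)

      E-length : List.length E ≡ q
      E-length = trans (length-map e (allFin q)) (length-tabulate id)

      r : ℕ
      r = List.length (Y ++ Z)

      n≡q+r : n ≡ q + r
      n≡q+r = trans (sym (length-tabulate {n = n} id)) (trans (↭.↭-length xs↭)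
        (trans (length-++ E) (cong (_+ r) E-length)))

      agree : ∀ {φ} → Colored φ → ∀ {j} → j ∈ jf → (φ ∘ ρ ∘ e) j ≡ suc (ptr j)
      agree {φ} φe j∈ = trans (cong φ (ptr-e j∈)) (φe _)

      colored⇒sucs : ∀ {φ} → Colored φ → map φ E ≡ sucs
      colored⇒sucs φe = trans (sym (map-∘ (allFin q))) (map-cong φe (allFin q))

      sucs⇒colored : ∀ {φ} → map φ E ≡ sucs → Colored φ
      sucs⇒colored h j = values-injective (allFin q) (trans (map-∘ (allFin q)) h) (∈-allFin j)

      module _ {D} (into : Into D jl) (ker : ∀ i → D i ≡ zero → i ≡ zero) (D-root : D zero ≡ zero)
               (iff : ∀ P → (∀ {j} → j ∈ jf → P j ≡ suc (ptr j)) →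
                      (Acyclic id (jf ++ jl) P → Acyclic D jl P) × (Acyclic D jl P → Acyclic id (jf ++ jl) P)) where

        -- A coloring is recorded by its values along `xs`, cut after the exits. The first word must
        -- be `sucs`, the second carries the tree condition, and the symmetry of `Φ` absorbs the
        -- change of order.
        values : ∀ Φ → Symmetric Φ → Trees Φ ≡ ∑[ v ← words (suc q) r ] (𝟙 (acyclicW? D jl v) * Φ (sucs ++ v))
        values Φ Φ-sym = begin
          Trees Φ
            ≡⟨ ∑-match R? (fns n (suc q)) (cartesianProduct (words (suc q) q) (words (suc q) r)) _
                 (λ (u , v) → 𝟙 (≡ᴸ-dec _≟_ u sucs) * (𝟙 (acyclicW? D jl v) * Φ (u ++ v)))
                 (λ {φ} {p} → weights {φ} {p}) (λ {φ} _ → one₁ φ) one₂ ⟩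
          ∑[ p ← cartesianProduct (words (suc q) q) (words (suc q) r) ] (𝟙 (≡ᴸ-dec _≟_ (proj₁ p) sucs) * (𝟙 (acyclicW? D jl (proj₂ p)) * Φ (proj₁ p ++ proj₂ p)))
            ≡⟨ ∑-cartesianProductWith _,_ (words (suc q) q) (words (suc q) r) _ ⟩
          ∑[ u ← words (suc q) q ] ∑[ v ← words (suc q) r ] (𝟙 (≡ᴸ-dec _≟_ u sucs) * (𝟙 (acyclicW? D jl v) * Φ (u ++ v)))
            ≡⟨ ∑-cong (words (suc q) q) (λ u → trans (∑-*ˡ (words (suc q) r) (𝟙 (≡ᴸ-dec _≟_ u sucs)) _)
                 (trans (𝟙-guard (≡ᴸ-dec _≟_ u sucs) (λ { refl → refl })) (cong (_* result) (𝟙-cong sym sym (≡ᴸ-dec _≟_ u sucs) (≡ᴸ-dec _≟_ sucs u))))) ⟩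
          ∑[ u ← words (suc q) q ] (𝟙 (≡ᴸ-dec _≟_ sucs u) * result)
            ≡⟨ ∑-*ʳ (words (suc q) q) result _ ⟩
          ∑[ u ← words (suc q) q ] 𝟙 (≡ᴸ-dec _≟_ sucs u) * result
            ≡⟨ cong (_* result) (words-one (suc q) q sucs (trans (length-map suc (allFin q)) (length-tabulate id))) ⟩
          1 * result
            ≡⟨ *-identityˡ result ⟩
          result ∎
          where
          open ≡-Reasoning
          result = ∑[ v ← words (suc q) r ] (𝟙 (acyclicW? D jl v) * Φ (sucs ++ v))
          R : (Fin n → Fin (suc q)) → List (Fin (suc q)) × List (Fin (suc q)) → Set
          R φ (u , v) = map φ E ≡ u × map φ (Y ++ Z) ≡ v
          R? : ∀ φ p → Dec (R φ p)
          R? φ (u , v) = ≡ᴸ-dec _≟_ (map φ E) u ×-dec ≡ᴸ-dec _≟_ (map φ (Y ++ Z)) v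
          weights : ∀ {φ p} → R φ p → 𝟙 (colored? φ) * (𝟙 (tree? (φ ∘ ρ ∘ e)) * Φ (map φ (allFin n))) ≡
                    𝟙 (≡ᴸ-dec _≟_ (proj₁ p) sucs) * (𝟙 (acyclicW? D jl (proj₂ p)) * Φ (proj₁ p ++ proj₂ p))
          weights {φ} (refl , refl) = trans
            (𝟙-guard (colored? φ) λ φe → cong₂ _*_
              (𝟙-cong
                (λ t → subst (AcyclicW D jl) (sym split) (acyclic⇒word D jl _ (proj₁ (iff _ (agree {φ} φe)) (tree⇒acyclic js-all js-unique t))))
                (λ a → acyclic⇒tree js-all js-unique (proj₂ (iff _ (agree {φ} φe)) (word⇒acyclic D jl _ (subst (AcyclicW D jl) split a))))
                (tree? (φ ∘ ρ ∘ e)) (acyclicW? D jl (map φ (Y ++ Z))))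
              (Φ-sym (Perm.trans (↭.map⁺ φ xs↭) (Perm.↭-reflexive (map-++ φ E (Y ++ Z))))))
            (cong (_* (𝟙 (acyclicW? D jl (map φ (Y ++ Z))) * Φ (map φ E ++ map φ (Y ++ Z)))) (𝟙-cong (colored⇒sucs {φ}) (sucs⇒colored {φ}) (colored? φ) (≡ᴸ-dec _≟_ (map φ E) sucs)))
            where
            split : map φ (Y ++ Z) ≡ map (φ ∘ ρ ∘ e) jl ++ map φ Z
            split = trans (map-++ φ Y Z) (cong (_++ map φ Z) (sym (map-∘ jl)))
          one₁ : ∀ φ → ∑[ p ← cartesianProduct (words (suc q) q) (words (suc q) r) ] 𝟙 (R? φ p) ≡ 1
          one₁ φ = trans (∑-cartesianProductWith _,_ (words (suc q) q) (words (suc q) r) _)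
            (trans (∑-cong (words (suc q) q) λ u → trans
               (∑-cong (words (suc q) r) λ v → 𝟙-× (≡ᴸ-dec _≟_ (map φ E) u) (≡ᴸ-dec _≟_ (map φ (Y ++ Z)) v))
               (trans (∑-*ˡ (words (suc q) r) (𝟙 (≡ᴸ-dec _≟_ (map φ E) u)) _)
               (trans (cong (𝟙 (≡ᴸ-dec _≟_ (map φ E) u) *_) (words-one (suc q) r (map φ (Y ++ Z)) (length-map φ (Y ++ Z)))) (*-identityʳ _))))
            (words-one (suc q) q (map φ E) (trans (length-map φ E) E-length)))
          one₂ : ∀ {p} → p ∈ cartesianProduct (words (suc q) q) (words (suc q) r) → ∑[ φ ← fns n (suc q) ] 𝟙 (R? φ p) ≡ 1
          one₂ p∈ with ∈-cartesianProductWith⁻ _,_ (words (suc q) q) (words (suc q) r) p∈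
          ... | u , v , u∈ , v∈ , refl = trans
            (∑-cong (fns n (suc q)) λ φ → 𝟙-cong
              (λ (a , b) → trans (map-++ φ E (Y ++ Z)) (cong₂ _++_ a b))
              (λ h → ++-injective (map φ E) u (trans (length-map φ E) (trans E-length (sym (words-length (suc q) q u∈)))) (trans (sym (map-++ φ E (Y ++ Z))) h))
              (R? φ (u , v)) (≡ᴸ-dec _≟_ (map φ xs) (u ++ v)))
            (fns-values-one zero xs xs-unique xs-all (u ++ v)
              (trans (length-++ u) (trans (cong₂ _+_ (words-length (suc q) q u∈) (words-length (suc q) r v∈)) (trans (cong (_+ r) (sym E-length)) (sym (length-++ E))))))
            where
            ++-injective : ∀ (a b : List (Fin (suc q))) {c d} → List.length a ≡ List.length b → a ++ c ≡ b ++ d → a ≡ b × c ≡ d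
            ++-injective []      []      l h = refl , h
            ++-injective (x ∷ a) (y ∷ b) l h with ++-injective a b (cong ℕ.pred l) (∷-injectiveʳ h)
            ... | f , g = cong₂ _∷_ (∷-injectiveˡ h) f , g

        trees-rest : ∀ Φ → Symmetric Φ → Trees Φ ≡ Rest Φ
        trees-rest Φ Φ-sym = trans (values Φ Φ-sym) (lem r refl)
          where
          lem : ∀ r′ → r′ ≡ r → ∑[ v ← words (suc q) r′ ] (𝟙 (acyclicW? D jl v) * Φ (sucs ++ v)) ≡ Rest Φ
          -- Without letters beyond the exits, `jl` is empty and every color lies in the root's
          -- class, which is a singleton; then `q` and `n` would be zero.
          lem zero r≡ = contradiction (trans n≡q+r (cong₂ _+_ (only-root q all-root) (sym r≡))) (ℕ.≢-nonZero⁻¹ n)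
            where
            all-root : ∀ i → i ≡ zero
            all-root i with into i
            ... | inj₁ h = ker i h
            ... | inj₂ (j , j∈ , _) = contradiction (trans r≡ (length-++ Y))
              (m<n⇒n≢0 (≤-trans (subst (0 <_) (sym (length-map (ρ ∘ e) jl)) (∈⇒nonempty j∈)) (m≤m+n _ _)) ∘ sym)
              where
              ∈⇒nonempty : ∀ {x : Fin q} {zs} → x ∈ zs → 0 < List.length zs
              ∈⇒nonempty {zs = _ ∷ _} _ = s≤s z≤n
            only-root : ∀ q → (∀ (i : Fin (suc q)) → i ≡ zero) → q ≡ 0
            only-root zero    h = refl
            only-root (suc q) h = contradiction (h (suc zero)) λ ()
          lem (suc k) r≡ = trans
            (acyclic-words jl D k (Φ ∘ (sucs ++_)) (Φ-sym ∘ ↭.++⁺ˡ sucs) into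
              (≤-trans (≤-reflexive (sym (length-map (ρ ∘ e) jl))) (≤-trans (m≤m+n _ _) (≤-reflexive (trans (sym (length-++ Y)) (sym r≡))))))
            (trans
              -- The class of the root is still `zero` alone, so the one constrained letter is
              -- `zero`.
              (∑-cong (words (suc q) k) λ b → ∑-delta (λ i → D i ≟ zero) {xs = allFin (suc q)} (λ i → Φ (sucs ++ i ∷ b))
                (AllPairs.map (λ x≢y (h , h′) → x≢y (trans (ker _ h) (sym (ker _ h′)))) (allFin⁺ (suc q)))
                (Any.map (λ { refl → D-root }) (∈-allFin zero))
                (λ i h → cong (λ i → Φ (sucs ++ i ∷ b)) (ker i h)))
              (cong (λ k → ∑[ b ← words (suc q) k ] Φ (sucs ++ zero ∷ b)) k≡))
            where
            k≡ : k ≡ n ∸ suc q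
            k≡ = sym (trans (cong (_∸ suc q) (trans n≡q+r (trans (cong (q +_) (sym r≡)) (+-suc q k)))) (m+n∸m≡n (suc q) k))

      count : ∃ λ α → ∀ Φ → Symmetric Φ → Trees Φ ≡ α * Rest Φ
      count with contract-chains jf {jl} id ptr id-into (λ _ → id) refl
        where
        id-into : Into id (jf ++ jl)
        id-into zero    = inj₁ refl
        id-into (suc j) = inj₂ (j , js-all j , refl)
      ... | inj₁ fail = 0 , λ Φ _ → none (λ φ φe t → fail _ (agree {φ} φe) (tree⇒acyclic js-all js-unique t)) Φ
      ... | inj₂ (D , into , ker , D-root , iff) = 1 , λ Φ Φ-sym → trans (trees-rest into ker D-root iff Φ Φ-sym) (sym (*-identityˡ _))

  -- `α` is chosen before `Φ`, so it cannot depend on the content later substituted for `Φ`. It is 0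
  -- if `e` takes an arc twice or the forced parents close a cycle, and 1 otherwise.
  trees-count : ∃ λ α → ∀ Φ → Symmetric Φ →
    ∑[ φ ← fns n (suc q) ] (𝟙 (all? λ j → φ (e j) ≟ suc j) * (𝟙 (tree? (φ ∘ ρ ∘ e)) * Φ (map φ (allFin n)))) ≡
    α * ∑[ b ← words (suc q) (n ∸ suc q) ] Φ (map suc (allFin q) ++ zero ∷ b)
  trees-count with all? (λ i → all? λ j → (e i ≟ e j) →-dec (i ≟ j))
  ... | yes inj = Injective.count (λ {i} {j} → inj i j)
  ... | no ¬inj = 0 , λ Φ _ → none (λ φ φe _ → ¬inj λ i j h → suc-injective (trans (sym (φe i)) (trans (cong φ h) (φe j)))) Φ

-- Words of prescribed content

occurs : ∀ {p} → Fin p → List (Fin p) → ℕ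
occurs u w = ∑[ i ← w ] 𝟙 (i ≟ u)

Content : ∀ {p} → (Fin p → ℕ) → List (Fin p) → Set
Content κ w = ∀ u → occurs u w ≡ κ u

content? : ∀ {p} (κ : Fin p → ℕ) w → Dec (Content κ w)
content? κ w = all? λ u → occurs u w ℕ.≟ κ u

-- The multinomial coefficient, by the first letter: removing `i` divides the product of factorials
-- by `κ i`, so the words that begin with `i` account for `κ i * m !`.
arrangements : ∀ {p} m (κ : Fin p → ℕ) → ∑ (allFin p) κ ≡ m →
               ∑[ w ← words p m ] 𝟙 (content? κ w) * ∏ (λ u → κ u !) ≡ m !
arrangements {p} zero κ s = cong₂ _*_ (cong (_+ 0) (𝟙-yes (content? κ []) (λ u → sym (zeros u)))) (∏-one {f = λ u → κ u !} λ u → cong _! (zeros u))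
  where
  zeros : ∀ u → κ u ≡ 0
  zeros u = go (allFin p) s (∈-allFin u)
    where
    go : ∀ xs → ∑ xs κ ≡ 0 → ∀ {u} → u ∈ xs → κ u ≡ 0
    go (x ∷ xs) e (here refl) = m+n≡0⇒m≡0 (κ x) e
    go (x ∷ xs) e (there i)   = go xs (m+n≡0⇒n≡0 (κ x) e) i
arrangements {p} (suc m) κ s = begin
  ∑[ w ← words p (suc m) ] 𝟙 (content? κ w) * Π
    ≡⟨ cong (_* Π) (∑-words p m (λ w → 𝟙 (content? κ w))) ⟩
  ∑[ i ← allFin p ] ∑[ w ← words p m ] 𝟙 (content? κ (i ∷ w)) * Π
    ≡⟨ ∑-*ʳ (allFin p) Π _ ⟨
  ∑[ i ← allFin p ] (∑[ w ← words p m ] 𝟙 (content? κ (i ∷ w)) * Π)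
    ≡⟨ ∑-cong (allFin p) (λ i → first i (κ i) refl) ⟩
  ∑[ i ← allFin p ] (κ i * m !)
    ≡⟨ ∑-*ʳ (allFin p) (m !) κ ⟩
  ∑ (allFin p) κ * m !
    ≡⟨ cong (_* m !) s ⟩
  suc m ! ∎
  where
  open ≡-Reasoning
  Π = ∏ (λ u → κ u !)
  first : ∀ i k → κ i ≡ k → ∑[ w ← words p m ] 𝟙 (content? κ (i ∷ w)) * Π ≡ κ i * m !
  first i zero e = trans (cong (_* Π) (trans (∑-cong (words p m) λ w → 𝟙-no (content? κ (i ∷ w)) λ h →
    contradiction (trans (sym (cong (_+ occurs i w) (𝟙-yes (i ≟ i) refl))) (trans (h i) e)) λ ()) (∑-zero (words p m)))) (cong (_* m !) (sym e))
  first i (suc k) e = begin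
    ∑[ w ← words p m ] 𝟙 (content? κ (i ∷ w)) * Π
      ≡⟨ cong₂ _*_ (∑-cong (words p m) λ w → 𝟙-cong
           (λ h u → +-cancelˡ-≡ (𝟙 (i ≟ u)) _ _ (trans (h u) (κ≡ u)))
           (λ h u → trans (cong (𝟙 (i ≟ u) +_) (h u)) (sym (κ≡ u)))
           (content? κ (i ∷ w)) (content? κ′ w))
         (∏-update (λ u → κ u !) (λ u → κ′ u !) i (κ i) at-i (λ u u≢i → cong _! (off u u≢i))) ⟩
    ∑[ w ← words p m ] 𝟙 (content? κ′ w) * (κ i * ∏ (λ u → κ′ u !))
      ≡⟨ solve 3 (λ a b c → a :* (b :* c) := b :* (a :* c)) refl (∑[ w ← words p m ] 𝟙 (content? κ′ w)) (κ i) (∏ (λ u → κ′ u !)) ⟩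
    κ i * (∑[ w ← words p m ] 𝟙 (content? κ′ w) * ∏ (λ u → κ′ u !))
      ≡⟨ cong (κ i *_) (arrangements m κ′ total) ⟩
    κ i * m ! ∎
    where
    open +-*-Solver
    κ′ : Fin p → ℕ
    κ′ u = κ u ∸ 𝟙 (i ≟ u)
    κ≡ : ∀ u → κ u ≡ 𝟙 (i ≟ u) + κ′ u
    κ≡ u = sym (m+[n∸m]≡n (le (i ≟ u)))
      where
      le : (d : Dec (i ≡ u)) → 𝟙 d ≤ κ u
      le (yes refl) = subst (1 ≤_) (sym e) (s≤s z≤n)
      le (no _)     = z≤n
    at-i : κ i ! ≡ κ i * κ′ i !
    at-i rewrite 𝟙-yes (i ≟ i) refl | e = refl
    off : ∀ u → u ≢ i → κ u ≡ κ′ u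
    off u u≢i rewrite 𝟙-no (i ≟ u) (u≢i ∘ sym) = refl
    total : ∑ (allFin p) κ′ ≡ m
    total = suc-inj (begin
      suc (∑ (allFin p) κ′)                                     ≡⟨ cong (_+ ∑ (allFin p) κ′) (sym (trans (∑-cong (allFin p) λ u → 𝟙-cong sym sym (i ≟ u) (u ≟ i)) (∑-unique _≟_ (allFin⁺ p) (∈-allFin i)))) ⟩
      ∑[ u ← allFin p ] 𝟙 (i ≟ u) + ∑ (allFin p) κ′             ≡⟨ ∑-+ (allFin p) (λ u → 𝟙 (i ≟ u)) κ′ ⟨
      ∑[ u ← allFin p ] (𝟙 (i ≟ u) + κ′ u)                      ≡⟨ ∑-cong (allFin p) (λ u → sym (κ≡ u)) ⟩
      ∑ (allFin p) κ                                            ≡⟨ s ⟩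
      suc m                                                     ∎)
      where
      suc-inj : ∀ {a b} → suc a ≡ suc b → a ≡ b
      suc-inj refl = refl

content-sym : ∀ {p} (κ : Fin p → ℕ) → Symmetric (λ w → 𝟙 (content? κ w))
content-sym κ {w} {w′} p = 𝟙-cong (λ h u → trans (∑-↭ (λ i → 𝟙 (i ≟ u)) (↭-sym p)) (h u)) (λ h u → trans (∑-↭ (λ i → 𝟙 (i ≟ u)) p) (h u)) (content? κ w) (content? κ w′)

-- The forced letters contain every color exactly once, so deleting them lowers all multiplicities
-- by one.
content-rest : ∀ {q} (γ : Fin (suc q) → ℕ) → (∀ u → 0 < γ u) → ∀ b →
  𝟙 (content? γ (map suc (allFin q) ++ zero ∷ b)) ≡ 𝟙 (content? (λ u → γ u ∸ 1) b)
content-rest {q} γ pos b = trans (content-sym γ (↭.shift zero (map suc (allFin q)) b))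
  (𝟙-cong (λ h u → cong (_∸ 1) (trans (sym (occ u)) (h u)))
          (λ h u → trans (occ u) (trans (cong suc (h u)) (m+[n∸m]≡n (pos u))))
          (content? γ (zero ∷ map suc (allFin q) ++ b)) (content? (λ u → γ u ∸ 1) b))
  where
  occ : ∀ u → occurs u (zero ∷ map suc (allFin q) ++ b) ≡ suc (occurs u b)
  occ u = trans (cong (λ xs → occurs u (zero ∷ xs ++ b)) (map-tabulate {n = q} id suc))
    (trans (∑-++ (allFin (suc q)) b _) (cong (_+ occurs u b) (∑-unique _≟_ (allFin⁺ (suc q)) (∈-allFin u))))

-- Colored tours of prescribed content

module _ {n q} .{{_ : NonZero n}} {ρ : Fin n → Fin n} (ρ-injective : ∀ {x y} → ρ x ≡ ρ y → x ≡ y)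
         (ρ-surjective : ∀ y → ∃ λ x → ρ x ≡ y)
         (γ : Fin (suc q) → ℕ) (γ-pos : ∀ u → 0 < γ u) (γ-sum : ∑ (allFin (suc q)) γ ≡ n) where

  private
    V = allFin n
    κ : Fin (suc q) → ℕ
    κ u = γ u ∸ 1

    κ-sum : ∑ (allFin (suc q)) κ ≡ n ∸ suc q
    κ-sum = begin
      ∑ (allFin (suc q)) κ                        ≡⟨ m+n∸m≡n (suc q) _ ⟨
      suc q + ∑ (allFin (suc q)) κ ∸ suc q        ≡⟨ cong (_∸ suc q) (begin
        suc q + ∑ (allFin (suc q)) κ                                 ≡⟨ cong (_+ ∑ (allFin (suc q)) κ) (trans (∑-one (allFin (suc q))) (length-tabulate {n = suc q} id)) ⟨
        ∑ (allFin (suc q)) (λ _ → 1) + ∑ (allFin (suc q)) κ          ≡⟨ ∑-+ (allFin (suc q)) (λ _ → 1) κ ⟨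
        ∑[ u ← allFin (suc q) ] (1 + κ u)                            ≡⟨ ∑-cong (allFin (suc q)) (λ u → m+[n∸m]≡n (γ-pos u)) ⟩
        ∑ (allFin (suc q)) γ                                         ≡⟨ γ-sum ⟩
        n                                                            ∎) ⟩
      n ∸ suc q                                   ∎
      where open ≡-Reasoning

  content⇒out : ∀ {φ : Fin n → Fin (suc q)} → Content γ (map φ V) → ∀ u → Tours.out φ ρ u V ≡ γ u
  content⇒out {φ} h u = trans (sym (∑-map V φ (λ i → 𝟙 (i ≟ u)))) (h u)

  ω-weight : ∏ (λ u → ω u (γ u)) ≡ γ zero * ∏ (λ u → κ u !)
  ω-weight = ∏-update (λ u → ω u (γ u)) (λ u → κ u !) zero (γ zero) (at-zero (γ zero) (γ-pos zero))
    λ { zero ne → contradiction refl ne ; (suc _) _ → refl }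
    where
    at-zero : ∀ g → 0 < g → g ! ≡ g * (g ∸ 1) !
    at-zero (suc g) _ = refl

  -- The content fixes the BEST weight, so the sums over `φ` and `e` can be exchanged. For each `e`
  -- the inner sum is `α e` times a multinomial coefficient, and the weight clears its denominator
  -- up to the factor `γ zero`.
  colored-tours : ∑[ φ ← fns n (suc q) ] (𝟙 (content? γ (map φ V)) * ∑[ l ← orders n V ] 𝟙 (Tours.path? φ ρ zero l)) ≡
                  γ zero * ((n ∸ suc q) ! * ∑[ e ← fns q n ] proj₁ (trees-count ρ-injective e))
  colored-tours = begin
    ∑[ φ ← F ] (𝟙 (content? γ (map φ V)) * ∑[ l ← orders n V ] 𝟙 (Tours.path? φ ρ zero l))
      ≡⟨ ∑-cong F (λ φ → 𝟙-guard (content? γ (map φ V)) λ h → trans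
           (closed-tours φ ρ (balanced φ) (λ j → subst (0 <_) (sym (content⇒out {φ} h (suc j))) (γ-pos (suc j))))
           (∑-cong G λ e → cong (λ w → 𝟙 (colored? e φ) * (𝟙 (tree? (φ ∘ ρ ∘ e)) * w)) (∏-cong λ u → cong (ω u) (content⇒out {φ} h u)))) ⟩
    ∑[ φ ← F ] (𝟙 (content? γ (map φ V)) * ∑[ e ← G ] (𝟙 (colored? e φ) * (𝟙 (tree? (φ ∘ ρ ∘ e)) * W)))
      ≡⟨ ∑-cong F (λ φ → trans (sym (∑-*ˡ G (𝟙 (content? γ (map φ V))) _)) (∑-cong G λ e → regroup (𝟙 (content? γ (map φ V))) (𝟙 (colored? e φ)) (𝟙 (tree? (φ ∘ ρ ∘ e))))) ⟩
    ∑[ φ ← F ] ∑[ e ← G ] (𝟙 (colored? e φ) * (𝟙 (tree? (φ ∘ ρ ∘ e)) * 𝟙 (content? γ (map φ V))) * W)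
      ≡⟨ ∑-swap F G _ ⟩
    ∑[ e ← G ] ∑[ φ ← F ] (𝟙 (colored? e φ) * (𝟙 (tree? (φ ∘ ρ ∘ e)) * 𝟙 (content? γ (map φ V))) * W)
      ≡⟨ ∑-cong G (λ e → trans (∑-*ʳ F W _) (cong (_* W) (trans (proj₂ (trees-count ρ-injective e) (λ w → 𝟙 (content? γ w)) (content-sym γ))
           (cong (α e *_) (∑-cong (words (suc q) (n ∸ suc q)) (content-rest γ γ-pos)))))) ⟩
    ∑[ e ← G ] (α e * Words * W)
      ≡⟨ ∑-cong G (λ e → trans (*-assoc (α e) Words W) (cong (α e *_) (trans (cong (Words *_) ω-weight)
           (trans (solve 3 (λ b g p → b :* (g :* p) := g :* (b :* p)) refl Words (γ zero) (∏ (λ u → κ u !))) (cong (γ zero *_) (arrangements (n ∸ suc q) κ κ-sum)))))) ⟩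
    ∑[ e ← G ] (α e * (γ zero * (n ∸ suc q) !))
      ≡⟨ ∑-*ʳ G (γ zero * (n ∸ suc q) !) α ⟩
    ∑ G α * (γ zero * (n ∸ suc q) !)
      ≡⟨ solve 3 (λ a g f → a :* (g :* f) := g :* (f :* a)) refl (∑ G α) (γ zero) ((n ∸ suc q) !) ⟩
    γ zero * ((n ∸ suc q) ! * ∑ G α) ∎
    where
    open ≡-Reasoning
    open +-*-Solver
    F = fns n (suc q)
    G = fns q n
    W = ∏ (λ u → ω u (γ u))
    Words = ∑[ b ← words (suc q) (n ∸ suc q) ] 𝟙 (content? κ b)
    α : (Fin q → Fin n) → ℕ
    α e = proj₁ (trees-count ρ-injective e)
    colored? : ∀ (e : Fin q → Fin n) (φ : Fin n → Fin (suc q)) → Dec (∀ j → φ (e j) ≡ suc j)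
    colored? e φ = all? λ j → φ (e j) ≟ suc j
    regroup : ∀ a b d → a * (b * (d * W)) ≡ b * (d * a) * W
    regroup a b d = solve 4 (λ a b d w → a :* (b :* (d :* w)) := b :* (d :* a) :* w) refl a b d W
    balanced : ∀ φ u → Tours.out φ ρ u V ≡ Tours.inn φ ρ u V
    balanced φ u = trans (∑-↭ _ (unique⇒↭ (allFin⁺ n) (Unique.map⁺ ρ-injective (allFin⁺ n)) (λ {y} _ → let x , e = ρ-surjective y in subst (_∈ map ρ V) e (∈-map⁺ ρ (∈-allFin x))) (λ _ → ∈-allFin _))) (∑-map V ρ (λ x → 𝟙 (φ x ≟ u)))

-- Closed tours and permutations

permutationSetoid : ℕ → DecSetoid 0ℓ 0ℓ
permutationSetoid n = record
  { Carrier = Permutation′ n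
  ; _≈_ = _≈ₚ_
  ; isDecEquivalence = record
    { isEquivalence = record
      { refl = λ _ → refl ; sym = λ e i → sym (e i) ; trans = λ e f i → trans (e i) (f i) }
    ; _≟_ = λ π ρ → all? λ i → π ⟨$⟩ʳ i ≟ ρ ⟨$⟩ʳ i
    }
  }

module Permutations (n : ℕ) = Enumerated (permutationSetoid n) permutations-complete

perms : ∀ n → List (Permutation′ n)
perms n = Permutations.elements n

injective : ∀ {n} (π : Permutation′ n) {x y} → π ⟨$⟩ʳ x ≡ π ⟨$⟩ʳ y → x ≡ y
injective π e = trans (sym (inverseˡ π)) (trans (cong (π ⟨$⟩ˡ_) e) (inverseˡ π))

map-perm-↭ : ∀ {n} (π : Permutation′ n) → map (π ⟨$⟩ʳ_) (allFin n) ↭ allFin n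
map-perm-↭ {n} π = unique⇒↭ (Unique.map⁺ (injective π) (allFin⁺ n)) (allFin⁺ n) (λ _ → ∈-allFin _)
  (λ {y} _ → subst (_∈ map (π ⟨$⟩ʳ_) (allFin n)) (inverseʳ π) (∈-map⁺ (π ⟨$⟩ʳ_) (∈-allFin (π ⟨$⟩ˡ y))))

longCycle-inject₁ : ∀ {m} (i : Fin m) → longCycle (suc m) (inject₁ i) ≡ suc i
longCycle-inject₁ {m} i = toℕ-injective (trans (toℕ-fromℕ< (m%n<n (suc (toℕ (inject₁ i))) (suc m)))
  (trans (cong (λ k → suc k % suc m) (toℕ-inject₁ i)) (m<n⇒m%n≡m (s≤s (toℕ<n i)))))

longCycle-fromℕ : ∀ m → longCycle (suc m) (fromℕ m) ≡ zero
longCycle-fromℕ m = toℕ-injective (trans (toℕ-fromℕ< (m%n<n (suc (toℕ (fromℕ m))) (suc m)))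
  (trans (cong (λ k → suc k % suc m) (toℕ-fromℕ m)) (n%n≡0 (suc m))))

longPerm : ∀ m → Permutation′ (suc m)
longPerm m = permutation (longCycle (suc m)) back forth-back back-forth
  where
  back : Fin (suc m) → Fin (suc m)
  back zero    = fromℕ m
  back (suc i) = inject₁ i
  forth-back : ∀ i → longCycle (suc m) (back i) ≡ i
  forth-back zero    = longCycle-fromℕ m
  forth-back (suc i) = longCycle-inject₁ i
  back-forth : ∀ i → back (longCycle (suc m) i) ≡ i
  back-forth i with view i
  ... | ‵fromℕ     = cong back (longCycle-fromℕ m)
  ... | ‵inject₁ i = cong back (longCycle-inject₁ i)

module _ {m p : ℕ} (φ : Fin (suc m) → Fin (suc p)) (ρ : Fin (suc m) → Fin (suc m)) where
  open Tours φ ρ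
  private
    n = suc m
    L = longCycle n
    V = allFin n

  -- With arcs placed at cyclic positions by `g`, each arc ends at the color where the next one
  -- begins: a closed Eulerian tour with a distinguished first position.
  Closed : Permutation′ n → Set
  Closed g = ∀ i → φ (g ⟨$⟩ʳ L i) ≡ φ (ρ (g ⟨$⟩ʳ i))

  closed? : ∀ g → Dec (Closed g)
  closed? g = all? λ i → φ (g ⟨$⟩ʳ L i) ≟ φ (ρ (g ⟨$⟩ʳ i))

  private
    at : Fin n → ℕ
    at i = ∑[ g ← perms n ] (𝟙 (closed? g) * 𝟙 (φ (g ⟨$⟩ʳ i) ≟ zero))

  -- Composing `g` with a rotation of the positions keeps the tour closed and moves the color at
  -- `L i` to position `i`.
  at-constant : ∀ i → at i ≡ at zero
  at-constant = <-weakInduction (λ i → at i ≡ at zero) refl λ i e → trans (trans (cong at (sym (longCycle-inject₁ i))) (shift (inject₁ i))) e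
    where
    rot = longPerm m
    shift : ∀ i → at (L i) ≡ at i
    shift i = trans
      (∑-cong (perms n) λ g → cong (_* 𝟙 (φ (g ⟨$⟩ʳ L i) ≟ zero)) (𝟙-cong (λ h i → h (L i))
         (λ h i → subst (λ i → φ (g ⟨$⟩ʳ L i) ≡ φ (ρ (g ⟨$⟩ʳ i))) (inverseʳ rot {i}) (h (rot ⟨$⟩ˡ i)))
         (closed? g) (closed? (rot ∘ₚ g))))
      (Permutations.elements-reindex n (rot ∘ₚ_) (flip rot ∘ₚ_) (λ e i → e (L i)) (λ e i → e (rot ⟨$⟩ˡ i))
        (λ g i → cong (g ⟨$⟩ʳ_) (inverseˡ rot)) (λ g i → cong (g ⟨$⟩ʳ_) (inverseʳ rot))
        (λ g → 𝟙 (closed? g) * 𝟙 (φ (g ⟨$⟩ʳ i) ≟ zero))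
        (λ {g} {h} e → cong₂ _*_
          (𝟙-cong (λ k i → trans (cong φ (sym (e (L i)))) (trans (k i) (cong (φ ∘ ρ) (e i))))
                  (λ k i → trans (cong φ (e (L i))) (trans (k i) (cong (φ ∘ ρ) (sym (e i))))) (closed? g) (closed? h))
          (cong (λ x → 𝟙 (φ x ≟ zero)) (e i))))

  -- Double count of the pairs of a closed `g` and a position whose arc starts at color zero: each
  -- `g` has `out zero V` such positions, and by rotation each position has equally many `g`.
  rooted : n * at zero ≡ out zero V * ∑[ g ← perms n ] 𝟙 (closed? g)
  rooted = begin
    n * at zero
      ≡⟨ cong (_* at zero) (trans (∑-one V) (length-tabulate {n = n} id)) ⟨
    ∑ V (λ _ → 1) * at zero
      ≡⟨ ∑-*ʳ V (at zero) (λ _ → 1) ⟨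
    ∑[ i ← V ] (1 * at zero)
      ≡⟨ ∑-cong V (λ i → trans (*-identityˡ _) (sym (at-constant i))) ⟩
    ∑[ i ← V ] at i
      ≡⟨ ∑-swap V (perms n) _ ⟩
    ∑[ g ← perms n ] ∑[ i ← V ] (𝟙 (closed? g) * 𝟙 (φ (g ⟨$⟩ʳ i) ≟ zero))
      ≡⟨ ∑-cong (perms n) (λ g → trans (∑-*ˡ V (𝟙 (closed? g)) (λ i → 𝟙 (φ (g ⟨$⟩ʳ i) ≟ zero)))
           (cong (𝟙 (closed? g) *_) (trans (sym (∑-map V (g ⟨$⟩ʳ_) (λ x → 𝟙 (φ x ≟ zero)))) (∑-↭ (λ x → 𝟙 (φ x ≟ zero)) (map-perm-↭ g))))) ⟩
    ∑[ g ← perms n ] (𝟙 (closed? g) * out zero V)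
      ≡⟨ ∑-*ʳ (perms n) (out zero V) _ ⟩
    ∑[ g ← perms n ] 𝟙 (closed? g) * out zero V
      ≡⟨ *-comm _ (out zero V) ⟩
    out zero V * ∑[ g ← perms n ] 𝟙 (closed? g) ∎
    where open ≡-Reasoning

  path⇒closed : ∀ {k} (g : Fin (suc k) → Fin n) {v} → Path v (List.tabulate g) →
    φ (g zero) ≡ v × (∀ i → φ (g (suc i)) ≡ φ (ρ (g (inject₁ i)))) × φ (ρ (g (fromℕ k))) ≡ zero
  path⇒closed {zero}  g (e , f) = e , (λ ()) , f
  path⇒closed {suc k} g (e , f) with path⇒closed (g ∘ suc) f
  ... | a , b , z = e , (λ { zero → a ; (suc i) → b i }) , z

  closed⇒path : ∀ {k} (g : Fin (suc k) → Fin n) {v} → φ (g zero) ≡ v →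
    (∀ i → φ (g (suc i)) ≡ φ (ρ (g (inject₁ i)))) → φ (ρ (g (fromℕ k))) ≡ zero → Path v (List.tabulate g)
  closed⇒path {zero}  g e b z = e , z
  closed⇒path {suc k} g e b z = e , closed⇒path (g ∘ suc) (b zero) (b ∘ suc) z

  -- `g` is matched with the list of its values. The condition at the last position, which
  -- `longCycle` sends back to the first, becomes the requirement that the path end at color zero.
  at-zero≡paths : at zero ≡ ∑[ l ← orders n V ] 𝟙 (path? zero l)
  at-zero≡paths = ∑-match (λ g l → ≡ᴸ-dec _≟_ l (List.tabulate (g ⟨$⟩ʳ_))) (perms n) (orders n V) _ _
    (λ { {g} refl → trans (sym (𝟙-× (closed? g) (φ (g ⟨$⟩ʳ zero) ≟ zero)))
      (𝟙-cong (λ (h , z) → closed⇒path (g ⟨$⟩ʳ_) z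
                  (λ i → trans (cong (λ x → φ (g ⟨$⟩ʳ x)) (sym (longCycle-inject₁ i))) (h (inject₁ i)))
                  (trans (sym (h (fromℕ m))) (trans (cong (λ x → φ (g ⟨$⟩ʳ x)) (longCycle-fromℕ m)) z)))
              (λ h → let a , b , z = path⇒closed (g ⟨$⟩ʳ_) h in close g a b z , a)
              (closed? g ×-dec (φ (g ⟨$⟩ʳ zero) ≟ zero)) (path? zero (List.tabulate (g ⟨$⟩ʳ_)))) })
    (λ {g} _ → orders-one _≟_ n (allFin⁺ n) (length-tabulate id)
       (subst (_↭ V) (map-tabulate id (g ⟨$⟩ʳ_)) (map-perm-↭ g)))
    (λ {l} l∈ → one (orders-↭ n (length-tabulate id) l∈))
    where
    close : ∀ g → φ (g ⟨$⟩ʳ zero) ≡ zero → (∀ i → φ (g ⟨$⟩ʳ suc i) ≡ φ (ρ (g ⟨$⟩ʳ inject₁ i))) →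
            φ (ρ (g ⟨$⟩ʳ fromℕ m)) ≡ zero → Closed g
    close g a b z i with view i
    ... | ‵fromℕ     = trans (cong (λ x → φ (g ⟨$⟩ʳ x)) (longCycle-fromℕ m)) (trans a (sym z))
    ... | ‵inject₁ i = trans (cong (λ x → φ (g ⟨$⟩ʳ x)) (longCycle-inject₁ i)) (b i)
    one : ∀ {l} → l ↭ V → ∑[ g ← perms n ] 𝟙 (≡ᴸ-dec _≟_ l (List.tabulate (g ⟨$⟩ʳ_))) ≡ 1
    one {l} p with assign zero V l (allFin⁺ n) (↭.↭-length p)
    ... | f , refl = Permutations.elements-one n _ π
      (λ {g} e → trans (map-cong e V) (map-tabulate id (g ⟨$⟩ʳ_)))
      (λ {g} e i → values-injective V (trans e (sym (map-tabulate id (g ⟨$⟩ʳ_)))) (∈-allFin i))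
      where
      f-surjective : ∀ y → ∃ λ x → f x ≡ y
      f-surjective y = let x , _ , e = ∈-map⁻ f (↭.∈-resp-↭ (↭-sym p) (∈-allFin y)) in x , sym e
      f-injective : ∀ {x y} → f x ≡ f y → x ≡ y
      f-injective = unique-map V (Unique-resp-↭ (↭-sym p) (allFin⁺ n)) (∈-allFin _) (∈-allFin _)
        where
        unique-map : ∀ xs → Unique (map f xs) → ∀ {x y} → x ∈ xs → y ∈ xs → f x ≡ f y → x ≡ y
        unique-map (x ∷ xs) u       (here refl) (here refl) e = refl
        unique-map (x ∷ xs) (a ∷ u) (here refl) (there j)   e = contradiction e (All.lookup a (∈-map⁺ f j))
        unique-map (x ∷ xs) (a ∷ u) (there i)   (here refl) e = contradiction (sym e) (All.lookup a (∈-map⁺ f i))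
        unique-map (x ∷ xs) (a ∷ u) (there i)   (there j)   e = unique-map xs u i j e
      π : Permutation′ n
      π = permutation f (proj₁ ∘ f-surjective) (proj₂ ∘ f-surjective) (λ x → f-injective (proj₂ (f-surjective (f x))))

-- Products of factors

module _ {m : ℕ} where

  private
    n = suc m
    L = longCycle n
    V = allFin n

  -- The equation says that `g` conjugates `L` into `s`. The solutions `g` for a given `s` are none
  -- or a coset of the centralizer of `L`.
  Centralizes : (Fin n → Fin n) → Permutation′ n → Set
  Centralizes s g = ∀ i → s (g ⟨$⟩ʳ i) ≡ g ⟨$⟩ʳ L i

  centralizes? : ∀ s g → Dec (Centralizes s g)
  centralizes? s g = all? λ i → s (g ⟨$⟩ʳ i) ≟ g ⟨$⟩ʳ L i

  -- n if s is an n-cycle and 0 otherwise.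
  Λ : (Fin n → Fin n) → ℕ
  Λ s = ∑[ g ← perms n ] 𝟙 (centralizes? s g)

  -- The two products are conjugate by `α`, and `g` is carried to `g ∘ₚ α`.
  Λ-swap : ∀ (α β : Permutation′ n) → Λ ((α ∘ₚ β) ⟨$⟩ʳ_) ≡ Λ ((β ∘ₚ α) ⟨$⟩ʳ_)
  Λ-swap α β = trans
    (∑-cong (perms n) λ g → 𝟙-cong
      (λ h i → cong (α ⟨$⟩ʳ_) (h i)) (λ h i → injective α (h i))
      (centralizes? ((α ∘ₚ β) ⟨$⟩ʳ_) g) (centralizes? ((β ∘ₚ α) ⟨$⟩ʳ_) (g ∘ₚ α)))
    (Permutations.elements-reindex n (_∘ₚ α) (_∘ₚ flip α) (λ e i → cong (α ⟨$⟩ʳ_) (e i)) (λ e i → cong (α ⟨$⟩ˡ_) (e i))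
      (λ g i → inverseʳ α) (λ g i → inverseˡ α) (λ g → 𝟙 (centralizes? ((β ∘ₚ α) ⟨$⟩ʳ_) g))
      (λ {g} {h} e → 𝟙-cong
        (λ k i → trans (cong ((β ∘ₚ α) ⟨$⟩ʳ_) (sym (e i))) (trans (k i) (e (L i))))
        (λ k i → trans (cong ((β ∘ₚ α) ⟨$⟩ʳ_) (e i)) (trans (k i) (sym (e (L i)))))
        (centralizes? ((β ∘ₚ α) ⟨$⟩ʳ_) g) (centralizes? ((β ∘ₚ α) ⟨$⟩ʳ_) h)))

  Valid : ∀ {p} → (Fin p → ℕ) → Permutation′ n × (Fin n → Fin p) → Set
  Valid γ (π , φ) = (∀ a → φ a ≡ φ (π ⟨$⟩ʳ a)) × Content γ (map φ V)

  valid? : ∀ {p} (γ : Fin p → ℕ) x → Dec (Valid γ x)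
  valid? γ (π , φ) = all? (λ a → φ a ≟ φ (π ⟨$⟩ʳ a)) ×-dec content? γ (map φ V)

  factors : ∀ {p} → (Fin p → ℕ) → List (Permutation′ n × (Fin n → Fin p))
  factors {p} γ = filter (valid? γ) (cartesianProduct (perms n) (fns n p))

  ∑-factors : ∀ {p} (γ : Fin p → ℕ) f →
    ∑ (factors γ) f ≡ ∑[ π ← perms n ] ∑[ φ ← fns n p ] (𝟙 (valid? γ (π , φ)) * f (π , φ))
  ∑-factors {p} γ f = trans (∑-filter (valid? γ) (cartesianProduct (perms n) (fns n p)) f)
    (∑-cartesianProductWith _,_ (perms n) (fns n p) (λ x → 𝟙 (valid? γ x) * f x))

  -- For fixed `φ` and `g` exactly one `π` makes the product with `ρ` equal to the cycle given by
  -- `g`, and `φ` is constant on the cycles of this `π` exactly when `g` is closed. The sum over `π`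
  -- thus collapses.
  factor-closing : ∀ {q} (γ : Fin (suc q) → ℕ) (ρ : Permutation′ n) →
    ∑[ x ← factors γ ] Λ ((ρ ∘ₚ proj₁ x) ⟨$⟩ʳ_) ≡
    ∑[ φ ← fns n (suc q) ] (𝟙 (content? γ (map φ V)) * ∑[ g ← perms n ] 𝟙 (closed? φ (ρ ⟨$⟩ʳ_) g))
  factor-closing {q} γ ρ = begin
    ∑[ x ← factors γ ] Λ ((ρ ∘ₚ proj₁ x) ⟨$⟩ʳ_)
      ≡⟨ ∑-factors γ (λ x → Λ ((ρ ∘ₚ proj₁ x) ⟨$⟩ʳ_)) ⟩
    ∑[ π ← perms n ] ∑[ φ ← F ] (𝟙 (valid? γ (π , φ)) * Λ ((ρ ∘ₚ π) ⟨$⟩ʳ_))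
      ≡⟨ ∑-swap (perms n) F (λ π φ → 𝟙 (valid? γ (π , φ)) * Λ ((ρ ∘ₚ π) ⟨$⟩ʳ_)) ⟩
    ∑[ φ ← F ] ∑[ π ← perms n ] (𝟙 (valid? γ (π , φ)) * Λ ((ρ ∘ₚ π) ⟨$⟩ʳ_))
      ≡⟨ ∑-cong F (λ φ → trans (∑-cong (perms n) λ π → regroup φ π) (trans (∑-*ˡ (perms n) (𝟙 (content? γ (map φ V))) _)
           (cong (𝟙 (content? γ (map φ V)) *_) (trans (∑-swap (perms n) (perms n) (λ π g → 𝟙 (centralizes? ((ρ ∘ₚ π) ⟨$⟩ʳ_) g) * 𝟙 (invariant? φ π))) (∑-cong (perms n) (only φ)))))) ⟩
    ∑[ φ ← F ] (𝟙 (content? γ (map φ V)) * ∑[ g ← perms n ] 𝟙 (closed? φ (ρ ⟨$⟩ʳ_) g)) ∎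
    where
    open ≡-Reasoning
    F = fns n (suc q)
    invariant? : ∀ (φ : Fin n → Fin (suc q)) (π : Permutation′ n) → Dec (∀ a → φ a ≡ φ (π ⟨$⟩ʳ a))
    invariant? φ π = all? λ a → φ a ≟ φ (π ⟨$⟩ʳ a)
    regroup : ∀ φ π → 𝟙 (valid? γ (π , φ)) * Λ ((ρ ∘ₚ π) ⟨$⟩ʳ_) ≡
              𝟙 (content? γ (map φ V)) * ∑[ g ← perms n ] (𝟙 (centralizes? ((ρ ∘ₚ π) ⟨$⟩ʳ_) g) * 𝟙 (invariant? φ π))
    regroup φ π = trans (cong (_* Λ ((ρ ∘ₚ π) ⟨$⟩ʳ_)) (𝟙-× (invariant? φ π) (content? γ (map φ V))))
      (trans (solve 3 (λ a b l → a :* b :* l := b :* (l :* a)) refl (𝟙 (invariant? φ π)) (𝟙 (content? γ (map φ V))) (Λ ((ρ ∘ₚ π) ⟨$⟩ʳ_)))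
      (cong (𝟙 (content? γ (map φ V)) *_) (sym (∑-*ʳ (perms n) (𝟙 (invariant? φ π)) (λ g → 𝟙 (centralizes? ((ρ ∘ₚ π) ⟨$⟩ʳ_) g))))))
      where open +-*-Solver
    only : ∀ φ g → ∑[ π ← perms n ] (𝟙 (centralizes? ((ρ ∘ₚ π) ⟨$⟩ʳ_) g) * 𝟙 (invariant? φ π)) ≡ 𝟙 (closed? φ (ρ ⟨$⟩ʳ_) g)
    only φ g = trans
      (∑-cong (perms n) λ π → 𝟙-guard (centralizes? ((ρ ∘ₚ π) ⟨$⟩ʳ_) g) λ c → 𝟙-cong
        (λ inv i → trans (cong φ (sym (c i))) (sym (inv _)))
        (λ cl a → let i = g ⟨$⟩ˡ (ρ ⟨$⟩ˡ a) ; e = trans (cong (ρ ⟨$⟩ʳ_) (inverseʳ g)) (inverseʳ ρ) in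
          trans (cong φ (sym e)) (trans (sym (cl i)) (cong φ (trans (sym (c i)) (cong (π ⟨$⟩ʳ_) e)))))
        (invariant? φ π) (closed? φ (ρ ⟨$⟩ʳ_) g))
      (trans (∑-*ʳ (perms n) (𝟙 (closed? φ (ρ ⟨$⟩ʳ_) g)) _)
      (trans (cong (_* 𝟙 (closed? φ (ρ ⟨$⟩ʳ_) g)) (Permutations.elements-one n (λ π → centralizes? ((ρ ∘ₚ π) ⟨$⟩ʳ_) g)
          -- The solution `g L g⁻¹ ρ⁻¹` of `π ρ g = g L`, written diagrammatically.
          (flip ρ ∘ₚ (flip g ∘ₚ (longPerm m ∘ₚ g)))
          (λ {π} e i → trans (sym (e (ρ ⟨$⟩ʳ (g ⟨$⟩ʳ i)))) (cong (λ x → g ⟨$⟩ʳ L x) (trans (cong (g ⟨$⟩ˡ_) (inverseˡ ρ)) (inverseˡ g))))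
          (λ {π} h a → trans (sym (h _)) (cong (π ⟨$⟩ʳ_) (trans (cong (ρ ⟨$⟩ʳ_) (inverseʳ g)) (inverseʳ ρ))))))
      (*-identityˡ _)))

  Sizes : ∀ {p} → (Fin p → ℕ) → Set
  Sizes {p} γ = (∀ u → 0 < γ u) × ∑ (allFin p) γ ≡ n

  -- `rooted` and `colored-tours` each bring a factor `γ zero`. After its cancellation only the
  -- number `suc q` of parts is left of `γ` on the right.
  factor-count : ∀ {q} (γ : Fin (suc q) → ℕ) → Sizes γ → ∀ (ρ : Permutation′ n) →
    ∑[ x ← factors γ ] Λ ((ρ ∘ₚ proj₁ x) ⟨$⟩ʳ_) ≡ n * ((n ∸ suc q) ! * ∑[ e ← fns q n ] proj₁ (trees-count (injective ρ) e))
  factor-count {q} γ (γ-pos , γ-sum) ρ = *-cancelˡ-≡ _ _ (γ zero) {{ℕ.>-nonZero (γ-pos zero)}} (begin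
    γ zero * ∑[ x ← factors γ ] Λ ((ρ ∘ₚ proj₁ x) ⟨$⟩ʳ_)
      ≡⟨ cong (γ zero *_) (factor-closing γ ρ) ⟩
    γ zero * ∑[ φ ← F ] (𝟙 (content? γ (map φ V)) * ∑[ g ← perms n ] 𝟙 (closed? φ (ρ ⟨$⟩ʳ_) g))
      ≡⟨ ∑-*ˡ F (γ zero) _ ⟨
    ∑[ φ ← F ] (γ zero * (𝟙 (content? γ (map φ V)) * ∑[ g ← perms n ] 𝟙 (closed? φ (ρ ⟨$⟩ʳ_) g)))
      ≡⟨ ∑-cong F (λ φ → trans (swap* (γ zero) (𝟙 (content? γ (map φ V))) _)
           (trans (𝟙-guard (content? γ (map φ V)) λ h → trans
              (cong (_* ∑[ g ← perms n ] 𝟙 (closed? φ (ρ ⟨$⟩ʳ_) g)) (sym (trans (sym (∑-map V φ (λ i → 𝟙 (i ≟ zero)))) (h zero))))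
              (trans (sym (rooted φ (ρ ⟨$⟩ʳ_))) (cong (n *_) (at-zero≡paths φ (ρ ⟨$⟩ʳ_)))))
           (swap* (𝟙 (content? γ (map φ V))) n _))) ⟩
    ∑[ φ ← F ] (n * (𝟙 (content? γ (map φ V)) * ∑[ l ← orders n V ] 𝟙 (Tours.path? φ (ρ ⟨$⟩ʳ_) zero l)))
      ≡⟨ ∑-*ˡ F n _ ⟩
    n * ∑[ φ ← F ] (𝟙 (content? γ (map φ V)) * ∑[ l ← orders n V ] 𝟙 (Tours.path? φ (ρ ⟨$⟩ʳ_) zero l))
      ≡⟨ cong (n *_) (colored-tours (injective ρ) (λ y → ρ ⟨$⟩ˡ y , inverseʳ ρ) γ γ-pos γ-sum) ⟩
    n * (γ zero * ((n ∸ suc q) ! * ∑[ e ← fns q n ] proj₁ (trees-count (injective ρ) e)))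
      ≡⟨ swap* n (γ zero) _ ⟩
    γ zero * (n * ((n ∸ suc q) ! * ∑[ e ← fns q n ] proj₁ (trees-count (injective ρ) e))) ∎)
    where
    open ≡-Reasoning
    F = fns n (suc q)
    swap* : ∀ a b d → a * (b * d) ≡ b * (a * d)
    swap* a b d = solve 3 (λ a b d → a :* (b :* d) := b :* (a :* d)) refl a b d
      where open +-*-Solver

  factor-symmetry : ∀ {p p′} (γ : Fin p → ℕ) (δ : Fin p′ → ℕ) → p ≡ p′ → Sizes γ → Sizes δ → ∀ (ρ : Permutation′ n) →
    ∑[ x ← factors γ ] Λ ((ρ ∘ₚ proj₁ x) ⟨$⟩ʳ_) ≡ ∑[ x ← factors δ ] Λ ((ρ ∘ₚ proj₁ x) ⟨$⟩ʳ_)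
  factor-symmetry {zero}  γ δ refl (_ , ()) _ ρ
  factor-symmetry {suc q} γ δ refl γs δs ρ = trans (factor-count γ γs ρ) (sym (factor-count δ δs ρ))

  -- A nested sum with the product passed to a continuation, so that one factor can be treated while
  -- the others are held fixed. The factors are multiplied in the order of `composite`.
  products : ∀ k {p : Fin k → ℕ} → (∀ t → Fin (p t) → ℕ) → (Permutation′ n → ℕ) → ℕ
  products zero    γ F = F idₚ
  products (suc k) γ F = ∑[ x ← factors (γ zero) ] products k (γ ∘ suc) (λ σ → F (σ ∘ₚ proj₁ x))

  products-families : ∀ k {p : Fin k → ℕ} (γ : ∀ t → Fin (p t) → ℕ) F →
    products k γ F ≡ ∑[ f ← families k (λ t → factors (γ t)) ] F (composite (λ t → proj₁ (f t)))
  products-families zero    γ F = sym (+-identityʳ _)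
  products-families (suc k) γ F = trans
    (∑-cong (factors (γ zero)) λ x → products-families k (γ ∘ suc) (λ σ → F (σ ∘ₚ proj₁ x)))
    (sym (∑-cartesianProductWith _ (factors (γ zero)) (families k (λ t → factors (γ (suc t)))) _))

  products-cong : ∀ k {p : Fin k → ℕ} (γ : ∀ t → Fin (p t) → ℕ) {F G} → (∀ σ → F σ ≡ G σ) → products k γ F ≡ products k γ G
  products-cong zero    γ e = e idₚ
  products-cong (suc k) γ e = ∑-cong (factors (γ zero)) λ x → products-cong k (γ ∘ suc) λ σ → e (σ ∘ₚ proj₁ x)

  products-∑ : ∀ k {p : Fin k → ℕ} (γ : ∀ t → Fin (p t) → ℕ) {A : Set} (xs : List A) (F : A → Permutation′ n → ℕ) →
    products k γ (λ σ → ∑[ x ← xs ] F x σ) ≡ ∑[ x ← xs ] products k γ (F x)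
  products-∑ zero    γ xs F = refl
  products-∑ (suc k) γ xs F = trans
    (∑-cong (factors (γ zero)) λ y → products-∑ k (γ ∘ suc) xs (λ x σ → F x (σ ∘ₚ proj₁ y)))
    (∑-swap (factors (γ zero)) xs _)

  -- `β` stores factors held fixed. `Λ-swap` rotates the first factor into `β`, the induction
  -- hypothesis changes the others, a second rotation brings it back, and `factor-symmetry` then
  -- changes it with the rest as `ρ`.
  products-symmetry : ∀ k {p p′ : Fin k → ℕ} (γ : ∀ t → Fin (p t) → ℕ) (δ : ∀ t → Fin (p′ t) → ℕ) →
    (∀ t → p t ≡ p′ t) → (∀ t → Sizes (γ t)) → (∀ t → Sizes (δ t)) → ∀ β →
    products k γ (λ σ → Λ ((β ∘ₚ σ) ⟨$⟩ʳ_)) ≡ products k δ (λ σ → Λ ((β ∘ₚ σ) ⟨$⟩ʳ_))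
  products-symmetry zero    γ δ e γs δs β = refl
  products-symmetry (suc k) γ δ e γs δs β = begin
    ∑[ x ← factors (γ zero) ] products k (γ ∘ suc) (λ σ → Λ ((β ∘ₚ (σ ∘ₚ proj₁ x)) ⟨$⟩ʳ_))
      ≡⟨ ∑-cong (factors (γ zero)) (λ x → trans (products-cong k (γ ∘ suc) (λ σ → Λ-swap (β ∘ₚ σ) (proj₁ x)))
           (trans (products-symmetry k (γ ∘ suc) (δ ∘ suc) (e ∘ suc) (γs ∘ suc) (δs ∘ suc) (proj₁ x ∘ₚ β))
                  (products-cong k (δ ∘ suc) (λ σ → Λ-swap (proj₁ x) (β ∘ₚ σ))))) ⟩
    ∑[ x ← factors (γ zero) ] products k (δ ∘ suc) (λ σ → Λ (((β ∘ₚ σ) ∘ₚ proj₁ x) ⟨$⟩ʳ_))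
      ≡⟨ products-∑ k (δ ∘ suc) (factors (γ zero)) (λ x σ → Λ (((β ∘ₚ σ) ∘ₚ proj₁ x) ⟨$⟩ʳ_)) ⟨
    products k (δ ∘ suc) (λ σ → ∑[ x ← factors (γ zero) ] Λ (((β ∘ₚ σ) ∘ₚ proj₁ x) ⟨$⟩ʳ_))
      ≡⟨ products-cong k (δ ∘ suc) (λ σ → factor-symmetry (γ zero) (δ zero) (e zero) (γs zero) (δs zero) (β ∘ₚ σ)) ⟩
    products k (δ ∘ suc) (λ σ → ∑[ x ← factors (δ zero) ] Λ (((β ∘ₚ σ) ∘ₚ proj₁ x) ⟨$⟩ʳ_))
      ≡⟨ products-∑ k (δ ∘ suc) (factors (δ zero)) (λ x σ → Λ (((β ∘ₚ σ) ∘ₚ proj₁ x) ⟨$⟩ʳ_)) ⟩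
    ∑[ x ← factors (δ zero) ] products k (δ ∘ suc) (λ σ → Λ ((β ∘ₚ (σ ∘ₚ proj₁ x)) ⟨$⟩ʳ_)) ∎
    where open ≡-Reasoning

  Extensional : (Permutation′ n → ℕ) → Set
  Extensional F = ∀ {σ τ} → σ ≈ₚ τ → F σ ≡ F τ

  module _ (g : Permutation′ n) where

    conj : Permutation′ n → Permutation′ n
    conj π = (g ∘ₚ π) ∘ₚ flip g

    conj-cong : ∀ {π σ} → π ≈ₚ σ → conj π ≈ₚ conj σ
    conj-cong e i = cong (g ⟨$⟩ˡ_) (e (g ⟨$⟩ʳ i))

    -- Conjugating the permutation and precomposing its coloring with `g` preserves validity and
    -- content, hence permutes the admissible pairs.
    conj-factors : ∀ {p} (γ : Fin p → ℕ) (G : Permutation′ n → ℕ) → Extensional G →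
      ∑[ x ← factors γ ] G (proj₁ x) ≡ ∑[ x ← factors γ ] G (conj (proj₁ x))
    conj-factors {p} γ G G-ext = begin
      ∑[ x ← factors γ ] G (proj₁ x)
        ≡⟨ ∑-factors γ (G ∘ proj₁) ⟩
      ∑[ π ← perms n ] H π
        ≡⟨ Permutations.elements-reindex n conj conj⁻ (λ {π} {σ} → conj-cong {π} {σ}) (λ e i → cong (g ⟨$⟩ʳ_) (e (g ⟨$⟩ˡ i)))
             (λ π i → trans (inverseˡ g) (cong (π ⟨$⟩ʳ_) (inverseˡ g))) (λ π i → trans (inverseʳ g) (cong (π ⟨$⟩ʳ_) (inverseʳ g))) H
             (λ {π} {σ} e → ∑-cong (fns n p) λ φ → cong₂ _*_
               (𝟙-cong (λ (a , b) → (λ x → trans (a x) (cong φ (e x))) , b) (λ (a , b) → (λ x → trans (a x) (cong φ (sym (e x)))) , b)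
                 (valid? γ (π , φ)) (valid? γ (σ , φ))) (G-ext e)) ⟨
      ∑[ π ← perms n ] H (conj π)
        ≡⟨ ∑-cong (perms n) (λ π → trans
             (sym (Functions.elements-reindex n p (_∘ (g ⟨$⟩ʳ_)) (_∘ (g ⟨$⟩ˡ_)) (λ e i → e (g ⟨$⟩ʳ i)) (λ e i → e (g ⟨$⟩ˡ i))
                (λ φ i → cong φ (inverseˡ g)) (λ φ i → cong φ (inverseʳ g)) (λ φ → 𝟙 (valid? γ (conj π , φ)) * G (conj π))
                (λ {φ} {ψ} e → cong (_* G (conj π)) (𝟙-cong (ext {conj π} e) (ext {conj π} (λ i → sym (e i))) (valid? γ (conj π , φ)) (valid? γ (conj π , ψ))))))
             (∑-cong (fns n p) λ φ → cong (_* G (conj π)) (𝟙-cong (to π φ) (from π φ) (valid? γ (conj π , φ ∘ (g ⟨$⟩ʳ_))) (valid? γ (π , φ))))) ⟩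
      ∑[ π ← perms n ] ∑[ φ ← fns n p ] (𝟙 (valid? γ (π , φ)) * G (conj π))
        ≡⟨ ∑-factors γ (G ∘ conj ∘ proj₁) ⟨
      ∑[ x ← factors γ ] G (conj (proj₁ x)) ∎
      where
      open ≡-Reasoning
      H : Permutation′ n → ℕ
      H π = ∑[ φ ← fns n p ] (𝟙 (valid? γ (π , φ)) * G π)
      conj⁻ : Permutation′ n → Permutation′ n
      conj⁻ π = (flip g ∘ₚ π) ∘ₚ g
      ext : ∀ {π φ ψ} → φ ≗ ψ → Valid γ (π , φ) → Valid γ (π , ψ)
      ext {π} e (a , b) = (λ x → trans (sym (e x)) (trans (a x) (e _))) , (λ u → trans (cong (occurs u) (map-cong (λ x → sym (e x)) V)) (b u))
      occurs-conj : ∀ φ u → occurs u (map (φ ∘ (g ⟨$⟩ʳ_)) V) ≡ occurs {p} u (map φ V)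
      occurs-conj φ u = trans (cong (occurs u) (map-∘ V)) (∑-↭ (λ i → 𝟙 (i ≟ u)) (↭.map⁺ φ (map-perm-↭ g)))
      to : ∀ π φ → Valid γ (conj π , φ ∘ (g ⟨$⟩ʳ_)) → Valid γ (π , φ)
      to π φ (a , b) = (λ x → trans (cong φ (sym (inverseʳ g))) (trans (a (g ⟨$⟩ˡ x)) (cong φ (trans (inverseʳ g) (cong (π ⟨$⟩ʳ_) (inverseʳ g))))))
        , (λ u → trans (sym (occurs-conj φ u)) (b u))
      from : ∀ π φ → Valid γ (π , φ) → Valid γ (conj π , φ ∘ (g ⟨$⟩ʳ_))
      from π φ (a , b) = (λ x → trans (a (g ⟨$⟩ʳ x)) (cong φ (sym (inverseʳ g)))) , (λ u → trans (occurs-conj φ u) (b u))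

    products-conj : ∀ k {p : Fin k → ℕ} (γ : ∀ t → Fin (p t) → ℕ) F → Extensional F →
      products k γ F ≡ products k γ (F ∘ conj)
    products-conj zero    γ F F-ext = F-ext (λ i → sym (inverseˡ g))
    products-conj (suc k) γ F F-ext = trans
      (conj-factors (γ zero) (λ π → products k (γ ∘ suc) (λ σ → F (σ ∘ₚ π)))
        (λ {π} {π′} e → products-cong k (γ ∘ suc) λ σ → F-ext {σ ∘ₚ π} {σ ∘ₚ π′} λ i → e (σ ⟨$⟩ʳ i)))
      (∑-cong (factors (γ zero)) λ x → trans
        (products-conj k (γ ∘ suc) (λ σ → F (σ ∘ₚ conj (proj₁ x))) (λ e → F-ext λ i → cong (conj (proj₁ x) ⟨$⟩ʳ_) (e i)))
        (products-cong k (γ ∘ suc) λ σ → F-ext λ i → cong (λ y → g ⟨$⟩ˡ (proj₁ x ⟨$⟩ʳ y)) (inverseʳ g)))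

  long? : ∀ (σ : Permutation′ n) → Dec (∀ i → σ ⟨$⟩ʳ i ≡ L i)
  long? σ = all? λ i → σ ⟨$⟩ʳ i ≟ L i

  -- Conjugating all factors by `g` does not change the count, and the conjugated product is the
  -- long cycle exactly when `g` conjugates `L` into the original one. Summing over `g` produces
  -- `Λ`.
  products-long : ∀ k {p : Fin k → ℕ} (γ : ∀ t → Fin (p t) → ℕ) →
    List.length (perms n) * products k γ (𝟙 ∘ long?) ≡ products k γ (λ σ → Λ (σ ⟨$⟩ʳ_))
  products-long k γ = begin
    List.length (perms n) * products k γ (𝟙 ∘ long?)
      ≡⟨ cong (_* products k γ (𝟙 ∘ long?)) (∑-one (perms n)) ⟨
    ∑ (perms n) (λ _ → 1) * products k γ (𝟙 ∘ long?)
      ≡⟨ ∑-*ʳ (perms n) (products k γ (𝟙 ∘ long?)) (λ _ → 1) ⟨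
    ∑[ g ← perms n ] (1 * products k γ (𝟙 ∘ long?))
      ≡⟨ ∑-cong (perms n) (λ g → trans (*-identityˡ _) (trans
           (products-conj g k γ (𝟙 ∘ long?) (λ {σ} {τ} e → 𝟙-cong (λ h i → trans (sym (e i)) (h i)) (λ h i → trans (e i) (h i)) (long? σ) (long? τ)))
           (products-cong k γ λ σ → 𝟙-cong
              (λ h i → trans (sym (inverseʳ g)) (cong (g ⟨$⟩ʳ_) (h i)))
              (λ h i → trans (cong (g ⟨$⟩ˡ_) (h i)) (inverseˡ g))
              (long? (conj g σ)) (centralizes? (σ ⟨$⟩ʳ_) g)))) ⟩
    ∑[ g ← perms n ] products k γ (λ σ → 𝟙 (centralizes? (σ ⟨$⟩ʳ_) g))
      ≡⟨ products-∑ k γ (perms n) (λ g σ → 𝟙 (centralizes? (σ ⟨$⟩ʳ_) g)) ⟨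
    products k γ (λ σ → Λ (σ ⟨$⟩ʳ_)) ∎
    where open ≡-Reasoning

-- The cardinality `c` as a sum over families of factors

families-one : ∀ k {A : Fin k → Set} {P : ∀ t → A t → Set} (P? : ∀ t x → Dec (P t x)) {xs : ∀ t → List (A t)} →
  (∀ t → ∑ (xs t) (𝟙 ∘ P? t) ≡ 1) → ∑[ f ← families k xs ] 𝟙 (all? λ t → P? t (f t)) ≡ 1
families-one zero    P? one = refl
families-one (suc k) {A} P? {xs} one = trans (∑-cartesianProductWith _ (xs zero) (families k (xs ∘ suc)) _)
  (trans (∑-cong (xs zero) λ x → trans
    (∑-cong (families k (xs ∘ suc)) λ f → split _)
    (trans (∑-*ˡ (families k (xs ∘ suc)) (𝟙 (P? zero x)) (λ f → 𝟙 (all? λ t → P? (suc t) (f t))))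
    (trans (cong (𝟙 (P? zero x) *_) (families-one k (P? ∘ suc) (one ∘ suc))) (*-identityʳ _))))
  (one zero))
  where
  split : ∀ (f : ∀ t → A t) → 𝟙 (all? λ t → P? t (f t)) ≡ 𝟙 (P? zero (f zero)) * 𝟙 (all? λ t → P? (suc t) (f (suc t)))
  split f = trans
    (𝟙-cong (λ h → h zero , h ∘ suc) (λ { (a , b) zero → a ; (a , b) (suc t) → b t })
      (all? λ t → P? t (f t)) (P? zero (f zero) ×-dec all? λ t → P? (suc t) (f (suc t))))
    (𝟙-× (P? zero (f zero)) (all? λ t → P? (suc t) (f (suc t))))

families-sound : ∀ k {A : Fin k → Set} {xs : ∀ t → List (A t)} {f} → f ∈ families k xs → ∀ t → f t ∈ xs t
families-sound (suc k) {xs = xs} f∈ t with ∈-cartesianProductWith⁻ _ (xs zero) (families k (xs ∘ suc)) f∈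
families-sound (suc k) f∈ zero    | x , g , x∈ , g∈ , refl = x∈
families-sound (suc k) f∈ (suc t) | x , g , x∈ , g∈ , refl = families-sound k g∈ t

occurs-member : ∀ {p} {u : Fin p} w → 0 < occurs u w → u ∈ w
occurs-member {u = u} (i ∷ w) o with i ≟ u
... | yes refl = here refl
... | no _     = there (occurs-member w o)

preimage-occurs : ∀ {n p} (φ : Fin n → Fin p) u → ∣ preimage φ u ∣ ≡ occurs u (map φ (allFin n))
preimage-occurs {n} φ u = trans (size (λ a → does (φ a ≟ u)))
  (trans (∑-cong (allFin n) λ a → lem (φ a ≟ u)) (sym (∑-map (allFin n) φ (λ i → 𝟙 (i ≟ u)))))
  where
  lem : ∀ {P : Set} (P? : Dec P) → 𝟙 (does P? Bool.≟ true) ≡ 𝟙 P?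
  lem (yes _) = refl
  lem (no _)  = refl
  size : ∀ {n} (b : Fin n → Bool) → ∣ Vec.tabulate b ∣ ≡ ∑[ a ← allFin n ] 𝟙 (b a Bool.≟ true)
  size {zero}  b = refl
  size {suc n} b with tail ← trans (size (b ∘ suc)) (trans (sym (∑-map (allFin n) suc (λ a → 𝟙 (b a Bool.≟ true)))) (cong (λ l → ∑[ a ← l ] 𝟙 (b a Bool.≟ true)) (map-tabulate {n = n} id suc))) | b zero
  ... | true  = cong suc tail
  ... | false = tail

module _ {m : ℕ} {k : ℕ} (γ : Fin k → Composition (suc m)) where

  private
    n = suc m
    V = allFin n
    open DecSetoid (coloredFactorizationsOf γ) using () renaming (Carrier to CF; _≈_ to _∼_)
    open Inverse (proj₂ (coloredFactorizationsOf-finite γ)) using (to; from; to-cong; strictlyInverseˡ; strictlyInverseʳ)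
    Family = ∀ t → Permutation′ n × (Fin n → Fin (length (γ t)))

  part-sizes : ∀ t → Sizes {m} (part (γ t))
  part-sizes t = (λ u → All.lookup (Composition.positive (γ t)) (∈-lookup u))
    , trans (cong sum (trans (map-tabulate id (part (γ t))) (tabulate-lookup (Composition.parts (γ t))))) (Composition.sum-parts (γ t))

  -- The indices counted by `c` stand for classes under pointwise equality, and the families of
  -- factors contain one representative of each class. The two are therefore matched by pointwise
  -- agreement, each side finding exactly one partner.
  c-products : c γ ≡ products {m} k (part ∘ γ) (𝟙 ∘ long?)
  c-products = begin
    c γ                                              ≡⟨ trans (∑-one (allFin (c γ))) (length-tabulate {n = c γ} id) ⟨
    ∑ (allFin (c γ)) (λ _ → 1)                       ≡⟨ ∑-match R? (allFin (c γ)) (filter product? fams) (λ _ → 1) (λ _ → 1) (λ _ → refl) (λ {i} _ → one₁ i) (λ {f} → one₂ f) ⟩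
    ∑ (filter product? fams) (λ _ → 1)               ≡⟨ ∑-filter product? fams (λ _ → 1) ⟩
    ∑[ f ← fams ] (𝟙 (product? f) * 1)               ≡⟨ ∑-cong fams (λ f → *-identityʳ _) ⟩
    ∑[ f ← fams ] 𝟙 (product? f)                     ≡⟨ products-families k (part ∘ γ) (𝟙 ∘ long?) ⟨
    products k (part ∘ γ) (𝟙 ∘ long?)                ∎
    where
    open ≡-Reasoning
    fams : List Family
    fams = families k (λ t → factors (part (γ t)))
    product? : ∀ (f : Family) → Dec (∀ i → composite (λ t → proj₁ (f t)) ⟨$⟩ʳ i ≡ longCycle n i)
    product? f = long? (composite (λ t → proj₁ (f t)))
    module F (F : CF) = ColoredFactorization (proj₁ F)
    R : Fin (c γ) → Family → Set
    R i f = ∀ t → (F.π (from i) t ≈ₚ proj₁ (f t)) × (F.φ (from i) t ≗ proj₂ (f t))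
    R? : ∀ i f → Dec (R i f)
    R? i f = all? λ t → (all? λ a → F.π (from i) t ⟨$⟩ʳ a ≟ proj₁ (f t) ⟨$⟩ʳ a) ×-dec (all? λ a → F.φ (from i) t a ≟ proj₂ (f t) a)
    one₁ : ∀ i → ∑[ f ← filter product? fams ] 𝟙 (R? i f) ≡ 1
    one₁ i = trans (∑-filter product? fams (λ f → 𝟙 (R? i f)))
      (trans (∑-cong fams λ f → absorb f (R? i f)) (families-one k _ λ t → factors-one t))
      where
      absorb : ∀ f (r : Dec (R i f)) → 𝟙 (product? f) * 𝟙 r ≡ 𝟙 r
      absorb f (no _)  = *-zeroʳ (𝟙 (product? f))
      absorb f (yes r) = cong (_* 1) (𝟙-yes (product? f) λ j →
        trans (sym (composite-cong k (λ t → proj₁ (r t)) j)) (F.factorizes (from i) j))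
      factors-one : ∀ t → ∑[ x ← factors (part (γ t)) ] 𝟙 ((all? λ a → F.π (from i) t ⟨$⟩ʳ a ≟ proj₁ x ⟨$⟩ʳ a) ×-dec (all? λ a → F.φ (from i) t a ≟ proj₂ x a)) ≡ 1
      factors-one t = trans (∑-factors (part (γ t)) (λ x → 𝟙 (π? (proj₁ x) ×-dec φ? (proj₂ x)))) (trans
        (∑-cong (perms n) λ π → trans
          (∑-cong (fns n (length (γ t))) λ φ → trans (guard π φ (π? π ×-dec φ? φ)) (𝟙-× (π? π) (φ? φ)))
          (trans (∑-*ˡ (fns n (length (γ t))) (𝟙 (π? π)) (𝟙 ∘ φ?))
          (trans (cong (𝟙 (π? π) *_) (fns-one φ? (F.φ (from i) t) id id)) (*-identityʳ _))))
        (Permutations.elements-one n π? (F.π (from i) t) id id))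
        where
        π? : ∀ π → Dec (F.π (from i) t ≈ₚ π)
        π? π = all? λ a → F.π (from i) t ⟨$⟩ʳ a ≟ π ⟨$⟩ʳ a
        φ? : ∀ φ → Dec (F.φ (from i) t ≗ φ)
        φ? φ = all? λ a → F.φ (from i) t a ≟ φ a
        guard : ∀ π φ (d : Dec ((F.π (from i) t ≈ₚ π) × (F.φ (from i) t ≗ φ))) → 𝟙 (valid? (part (γ t)) (π , φ)) * 𝟙 d ≡ 𝟙 d
        guard π φ (no _)        = *-zeroʳ (𝟙 (valid? (part (γ t)) (π , φ)))
        guard π φ (yes (e , h)) = cong (_* 1) (𝟙-yes (valid? (part (γ t)) (π , φ))
          ( (λ a → trans (sym (h a)) (trans (F.cycle-invariant (from i) t a _ (1 , e a)) (h _)))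
          , (λ u → trans (cong (occurs u) (map-cong (λ a → sym (h a)) V)) (trans (sym (preimage-occurs (F.φ (from i) t) u)) (proj₂ (from i) t u)))))
    one₂ : ∀ f → f ∈ filter product? fams → ∑[ i ← allFin (c γ) ] 𝟙 (R? i f) ≡ 1
    one₂ f f∈ = trans (∑-cong (allFin (c γ)) λ i → 𝟙-cong only (λ { refl t → (λ a → proj₁ back t a) , (λ a → proj₂ back t a) }) (R? i f) (i ≟ to G)) (∑-unique _≟_ (allFin⁺ (c γ)) (∈-allFin (to G)))
      where
      f∈′ = ∈-filter⁻ product? {xs = fams} f∈
      valid : ∀ t → Valid {m} (part (γ t)) (f t)
      valid t = proj₂ (∈-filter⁻ (valid? (part (γ t))) {xs = cartesianProduct (perms n) (fns n (length (γ t)))} (families-sound k (proj₁ f∈′) t))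
      occupied : ∀ t u → ∃ λ a → proj₂ (f t) a ≡ u
      occupied t u =
        let a , _ , e = ∈-map⁻ (proj₂ (f t)) (occurs-member (map (proj₂ (f t)) V) (subst (0 <_) (sym (proj₂ (valid t) u)) (proj₁ (part-sizes t) u)))
        in a , sym e
      G : CF
      G = record
        { π = λ t → proj₁ (f t)
        ; φ = λ t → proj₂ (f t)
        ; factorizes = proj₂ f∈′
        ; surjective = λ t → strictlySurjective⇒surjective (occupied t)
        ; cycle-invariant = λ t → step⇒cycle-invariant (proj₁ (f t)) (proj₂ (f t)) (proj₁ (valid t))
        } , λ t u → trans (preimage-occurs (proj₂ (f t)) u) (proj₂ (valid t) u)
      back : from (to G) ∼ G
      back = strictlyInverseʳ G
      only : ∀ {i} → R i f → i ≡ to G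
      only {i} r = trans (sym (strictlyInverseˡ i)) (to-cong ((λ t → proj₁ (r t)) , (λ t → proj₂ (r t))))

perms-nonempty : ∀ n → List.length (perms n) ≢ 0
perms-nonempty n = nonempty (perms n) (Permutations.elements-one n (λ π → all? λ i → i ≟ π ⟨$⟩ʳ i) idₚ id id)
  where
  nonempty : ∀ (xs : List A) {f} → ∑ xs f ≡ 1 → List.length xs ≢ 0
  nonempty [] ()
  nonempty (_ ∷ _) _ ()

theorem1p3 : ∀ (k n : ℕ) .{{_ : NonZero n}} → k ≥ 2 →
    (γ δ : Fin k → Composition n) →
    (∀ t → length (γ t) ≡ length (δ t)) →
    c γ ≡ c δ
theorem1p3 k zero {{n≢0}} _ γ δ same = contradiction refl (ℕ.≢-nonZero⁻¹ 0 {{n≢0}})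
theorem1p3 k (suc m) _ γ δ same = *-cancelˡ-≡ _ _ N {{ℕ.≢-nonZero (perms-nonempty (suc m))}} (begin
  N * c γ                                              ≡⟨ cong (N *_) (c-products γ) ⟩
  N * products k (part ∘ γ) (𝟙 ∘ long?)                ≡⟨ products-long k (part ∘ γ) ⟩
  products k (part ∘ γ) (λ σ → Λ (σ ⟨$⟩ʳ_))            ≡⟨ products-symmetry k (part ∘ γ) (part ∘ δ) same (part-sizes γ) (part-sizes δ) idₚ ⟩
  products k (part ∘ δ) (λ σ → Λ (σ ⟨$⟩ʳ_))            ≡⟨ products-long k (part ∘ δ) ⟨
  N * products k (part ∘ δ) (𝟙 ∘ long?)                ≡⟨ cong (N *_) (c-products δ) ⟨
  N * c δ                                              ∎)
  where
  open ≡-Reasoning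
  N = List.length (perms (suc m))
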